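{- For integers $0\leq k\leq n$, \[ (1-q)^{n-k} S_1[n,k] = \sum_{j=0}^{n-k} \sum_{i=j}^{n-k} (-1)^j\, B^{n,k}_{i,j}\, q^{\binom{j+1}2} \begin{bmatrix} i\\ j\end{bmatrix}_q . \]
   Context: $q$-binomial coefficients: $[i]_q=1+q+\dots+q^{i-1}$, $[n]_q!=[1]_q\cdots[n]_q$, $\begin{bmatrix} n\\ k\end{bmatrix}_q=\frac{[n]_q!}{[k]_q![n-k]_q!}$ for $0\leq k\leq n$, and $0$ if $k<0$ or $k>n$. For integers $0\leq j\leq i\leq n-k$, \[ B^{n,k}_{i,j}=\binom{n+j-1}{k-1}\binom{n-i-1}{k-1}-\binom{n+j}{k-1}\binom{n-i-2}{k-1}, \] which also equals $\frac{i+j+1}{n+j}\binom{n+j}{k-1}\binom{n-i-2}{k-2}$; here the conventions $\binom{ -2}{ -2}=\binom{ -1}{ -1}=1$ and $\binom{u}{v}=0$ if $v<0$ and $u>v$ are used. For $n\geq 0$ let $\mathfrak{S}_n$ be the set of permutations of $\{1,\dots,n\}$. For $\sigma\in\mathfrak{S}_n$, a right-to-left maximum is an index $i$ such that $\sigma(i)>\sigma(j)$ for all $j$ with $i<j\leq n$; let $\mathrm{rlm}(\sigma)$ be their number. An inversion of $\sigma$ is a pair $(i,j)$ with $i<j$ and $\sigma(i)>\sigma(j)$; it is special if there exists $k'$ with $j<k'\leq n$ and $\sigma(i)<\sigma(k')$. Let $\mathrm{inv}'(\sigma)$ be the number of special inversions. Define $S_1[n,k]=\sum_{\sigma} q^{\mathrm{inv}'(\sigma)}$,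 summed over $\sigma\in\mathfrak{S}_n$ with $\mathrm{rlm}(\sigma)=k$. -}

module Defs where

open import Data.Bool using (Bool; true; false; if_then_else_; _∧_)
open import Data.Nat as ℕ using (ℕ; zero; suc; _∸_; _≤ᵇ_; _<ᵇ_)
open import Data.Nat.Combinatorics using (_C_)
open import Data.Integer as ℤ using (ℤ; +_; -[1+_]; 0ℤ; 1ℤ)
open import Data.Fin using (Fin; toℕ)
open import Data.Fin.Properties using () renaming (_≟_ to _≟F_)
open import Data.List using (List; []; _∷_; [_]; map; concatMap; allFin; upTo;
                             filter; replicate; _++_; reverse; length; foldr)
open import Data.Bool.ListAction using (all; any)
open import Data.List.Relation.Unary.Unique.Propositional using (Unique)
import Data.List.Relation.Unary.Unique.DecPropositional as UDec
open import Relation.Binary.PropositionalEquality using (_≡_)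

-- Polynomials in q with integer coefficients, as coefficient lists
-- (entry m is the coefficient of q^m).

Poly : Set
Poly = List ℤ

infixl 6 _⊕_
infixl 7 _⊛_

_⊕_ : Poly → Poly → Poly
[]       ⊕ q        = q
p        ⊕ []       = p
(a ∷ p)  ⊕ (b ∷ q)  = (a ℤ.+ b) ∷ (p ⊕ q)

scale : ℤ → Poly → Poly
scale c p = map (c ℤ.*_) p

_⊛_ : Poly → Poly → Poly
[]      ⊛ q = []
(a ∷ p) ⊛ q = scale a q ⊕ (0ℤ ∷ (p ⊛ q))

coeff : Poly → ℕ → ℤ
coeff []      m       = 0ℤ
coeff (a ∷ p) zero    = a
coeff (a ∷ p) (suc m) = coeff p m

infix 4 _≈P_
_≈P_ : Poly → Poly → Set
p ≈P r = ∀ m → coeff p m ≡ coeff r m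

qpow : ℕ → Poly
qpow m = replicate m 0ℤ ++ [ 1ℤ ]

_^P_ : Poly → ℕ → Poly
p ^P zero  = [ 1ℤ ]
p ^P suc e = p ⊛ (p ^P e)

sumP : List Poly → Poly
sumP = foldr _⊕_ []

trim : Poly → Poly
trim p = reverse (dropZ (reverse p))
  where
  dropZ : List ℤ → List ℤ
  dropZ []              = []
  dropZ (+ zero ∷ xs)   = dropZ xs
  dropZ (x ∷ xs)        = x ∷ xs

private
  -- subtract (c * bs) from the front of r (lists are highest degree first)
  subFront : List ℤ → List ℤ → List ℤ
  subFront r        []       = r
  subFront []       (b ∷ bs) = []
  subFront (x ∷ xs) (b ∷ bs) = (x ℤ.- b) ∷ subFront xs bs

  -- long division, high-degree-first; bs = lower coefficients of the
  -- monic divisor (high first), d = its degree; fuel bounds the steps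
  go : ℕ → ℕ → List ℤ → List ℤ → List ℤ
  go zero     d bs r        = []
  go (suc f)  d bs []       = []
  go (suc f)  d bs (c ∷ r)  =
    if d ≤ᵇ length r then c ∷ go f d bs (subFront r (map (c ℤ.*_) bs)) else []

divMonic : Poly → Poly → Poly
divMonic A B with reverse (trim B)
... | []      = []
... | _ ∷ bs  = reverse (go (length rA) (length bs) bs rA)
  where rA = reverse (trim A)

qint : ℕ → Poly
qint i = replicate i 1ℤ

qfact : ℕ → Poly
qfact zero    = [ 1ℤ ]
qfact (suc n) = qfact n ⊛ qint (suc n)

qbinom : ℕ → ℕ → Poly
qbinom n k = if k ≤ᵇ n then divMonic (qfact n) (qfact k ⊛ qfact (n ∸ k)) else []

-- Binomial coefficients with integer arguments, with the paper's
-- conventions: usual value for 0 ≤ v ≤ u, C(u,u) = 1 also for u < 0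
-- (in particular C(-1,-1) = C(-2,-2) = 1), and 0 otherwise.

binomZ : ℤ → ℤ → ℤ
binomZ (+ u)    (+ v)    = + (u C v)
binomZ -[1+ u ] -[1+ v ] = if u ℕ.≡ᵇ v then 1ℤ else 0ℤ
binomZ (+ u)    -[1+ v ] = 0ℤ
binomZ -[1+ u ] (+ v)    = 0ℤ

B : ℕ → ℕ → ℕ → ℕ → ℤ
B n k i j =
  binomZ (+ (n ℕ.+ j) ℤ.- 1ℤ) (+ k ℤ.- 1ℤ) ℤ.* binomZ (+ n ℤ.- + i ℤ.- 1ℤ) (+ k ℤ.- 1ℤ)
  ℤ.- binomZ (+ (n ℕ.+ j)) (+ k ℤ.- 1ℤ) ℤ.* binomZ (+ n ℤ.- + i ℤ.- + 2) (+ k ℤ.- 1ℤ)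

-- Permutations of {1..n} in one-line notation: the words
-- σ(1) σ(2) ... σ(n) of length n over Fin n with no repeated letter.

words : (n m : ℕ) → List (List (Fin n))
words n zero    = [ [] ]
words n (suc m) = concatMap (λ x → map (x ∷_) (words n m)) (allFin n)


Sym : (n : ℕ) → List (List (Fin n))
Sym n = filter (UDec.unique? _≟F_) (words n n)

rlm : {n : ℕ} → List (Fin n) → ℕ
rlm []       = 0
rlm (x ∷ xs) = (if all (λ y → toℕ y <ᵇ toℕ x) xs then 1 else 0) ℕ.+ rlm xs

-- number of special inversions (i,j) with first entry x = σ(i):
-- j > i, σ(i) > σ(j), and some k' > j with σ(i) < σ(k')
special : {n : ℕ} → Fin n → List (Fin n) → ℕ
special x []       = 0
special x (y ∷ ys) =
  (if (toℕ y <ᵇ toℕ x) ∧ any (λ z → toℕ x <ᵇ toℕ z) ys then 1 else 0) ℕ.+ special x ys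

inv′ : {n : ℕ} → List (Fin n) → ℕ
inv′ []       = 0
inv′ (x ∷ xs) = special x xs ℕ.+ inv′ xs

S₁ : ℕ → ℕ → Poly
S₁ n k = sumP (map (λ σ → qpow (inv′ σ)) (filterᵇ (λ σ → rlm σ ℕ.≡ᵇ k) (Sym n)))
  where
  filterᵇ : {A : Set} → (A → Bool) → List A → List A
  filterᵇ p []       = []
  filterᵇ p (x ∷ xs) = if p x then x ∷ filterᵇ p xs else filterᵇ p xs

sign : ℕ → ℤ
sign zero    = 1ℤ
sign (suc j) = ℤ.- sign j

RHS : ℕ → ℕ → Poly
RHS n k =
  sumP (map (λ j →
    sumP (map (λ i → scale (sign j ℤ.* B n k i j) (qpow (suc j C 2) ⊛ qbinom i j))
              (map (j ℕ.+_) (upTo (suc (n ∸ k) ∸ j)))))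
    (upTo (suc (n ∸ k))))

oneMinusQ : Poly
oneMinusQ = 1ℤ ∷ ℤ.- 1ℤ ∷ []

module Submission where

-- Read σ from right to left. Let h be the number of unused values below the current maximum and u the
-- number above it. If each special inversion is counted at its smaller letter, then the choices of a
-- letter that is not a record contribute 1 + q + ⋯ + q^(h-1) and lower h by one, while a record moves
-- some a values from above the maximum to below it. Multiplying by 1 - q for each letter that is not a
-- record turns this into weights 1 - q^h on lattice paths, governed by the operator
--   ψ(h) ↦ (1 + t (1 - q^h)) ψ(h) - t ψ(h+1) - (1 - q^h) ψ(h-1),
-- whose eigenvectors are continuous big q-Hermite functions: for the eigenvalue (1 - 1/x)(1 - t x) the
-- minimal solution is x^h Σ_i (t x)^i (1 - x q) ⋯ (1 - x q^i) (1 - q^(i+1)) ⋯ (1 - q^(i+h)).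
-- The coefficients of its expansion in powers of the eigenvalue are residues at x = 1; at h = 0, after
-- expanding (1 - x q) ⋯ (1 - x q^i) by the q-binomial theorem, they are the right-hand side.

-- Write z for the eigenvalue (1 - 1/x)(1 - t x). The residues are never formed analytically. C(m,
-- κ) is the coefficient of (x - 1)^κ in x^m, so taking the residue at x = 1 of a polynomial over (x
-- - 1)^(κ+1) is the linear map x^m ↦ C(m, κ). In the eigenfunction, up to its factor x^h, and in (1
-- - t x)^(-κ-1), t occurs only as t x. The coefficient of t^s therefore carries x^s, and the
-- denominator becomes (1 - t)^(-κ-1). Finally dz = (1/x^2 - t) dx splits each residue into two
-- terms, which is why `closed` and `B` are differences of two products. The eigenvector is
-- normalized by the equation at h = 0, which has an inhomogeneous term: ψ(0) - t ψ(1) = 1 + z ψ(0).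
-- It makes ψ(h) equal to x times the series of the header. The closed form is verified rather than
-- derived: it satisfies the recurrences that define the path counts, and these determine their
-- solution by induction on κ, s and h, so that neither convergence nor minimality has to be
-- discussed.

open import Defs
open import Level using (0ℓ)
open import Algebra.Bundles using (CommutativeRing; RawRing)
open import Algebra.Solver.Ring.AlmostCommutativeRing
  using (fromCommutativeRing; _-Raw-AlmostCommutative⟶_)
import Algebra.Solver.Ring
import Algebra.Properties.CommutativeSemigroup as CommutativeSemigroupₚ
open import Data.Bool using (Bool; true; false; if_then_else_; _∧_; _∨_; not; T)
open import Data.Bool.ListAction using (all; any)
import Data.Bool.Properties as 𝔹ₚ
open import Data.Fin using (Fin; toℕ)
import Data.Fin.Properties as Finₚ
open import Data.Integer as ℤ using (ℤ; 0ℤ; 1ℤ; +_; -[1+_])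
import Data.Integer.Properties as ℤₚ
open import Data.Integer.Tactic.RingSolver using () renaming (solve-∀ to ℤ-solve)
open import Data.List using (List; []; _∷_; _++_; map; foldr; length; reverse; filter; concatMap;
                             allFin; tabulate; applyUpTo; upTo)
import Data.List.Properties as Listₚ
import Data.List.Relation.Unary.All as All
import Data.List.Relation.Unary.Unique.DecPropositional as UDec
open import Data.Maybe using (Maybe; just; nothing)
open import Data.Nat as ℕ using (ℕ; zero; suc; _∸_; _≤_; _<_; z≤n; s≤s; _⊔_; _≤ᵇ_; _<ᵇ_; _≡ᵇ_)
open import Data.Nat.Combinatorics
  using (_C_; nCk≡nC[n∸k]; nCn≡1; nC1≡n; k>n⇒nCk≡0; nCk+nC[k+1]≡[n+1]C[k+1])
import Data.Nat.Properties as ℕₚ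
open import Data.Nat.Solver using (module +-*-Solver)
open import Data.Product using (_,_; _×_; ∃; proj₁; proj₂)
open import Function using (_∘_; id)
open import Relation.Binary.Definitions using (tri<; tri≈; tri>)
open import Relation.Binary.PropositionalEquality as ≡ using (_≡_)
open import Relation.Nullary using (yes; no; contradiction; ¬_; does)
open import Relation.Nullary.Decidable using (¬?)

-- Defs keeps its division loop, its zero trimming and its filter private; each equation below
-- names the hidden function by letting unification solve for it.
mutual
  divLoop : ℕ → ℕ → List ℤ → List ℤ → List ℤ
  divLoop = _

  divMonic-unfold : ∀ A B b bs → reverse (trim B) ≡ b ∷ bs →
    divMonic A B ≡ reverse (divLoop (length (reverse (trim A))) (length bs) bs (reverse (trim A)))
  divMonic-unfold A B b bs eq with reverse (trim B)
  divMonic-unfold A B b bs ≡.refl | _ with reverse (trim A)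
  -- With all arguments turned into variables, and `reverse` as well so that its argument is
  -- compared, the two sides form a pattern problem with a unique solution for `divLoop`.
  ... | r with length r | length bs
  ... | x | y with reverse {A = ℤ}
  ... | rev = ≡.refl

mutual
  subtract : List ℤ → List ℤ → List ℤ
  subtract = _

  divLoop-unfold : ∀ f d bs c r → divLoop (suc f) d bs (c ∷ r) ≡
    (if d ≤ᵇ length r then c ∷ divLoop f d bs (subtract r (map (c ℤ.*_) bs)) else [])
  divLoop-unfold f d bs c r with map (c ℤ.*_) bs | d ≤ᵇ length r
  ... | x | true  = ≡.refl
  ... | x | false = ≡.refl

mutual
  dropZeros : Poly → List ℤ → List ℤ
  dropZeros = _

  trim-unfold : ∀ p → trim p ≡ reverse (dropZeros p (reverse p))
  trim-unfold p with reverse p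
  ... | r with reverse {A = ℤ}
  ... | rev = ≡.refl

mutual
  withRecords : ∀ n (k : ℕ) → List (List (Fin n)) → List (List (Fin n))
  withRecords = _

  S₁-unfold : ∀ n k → S₁ n k ≡ sumP (map (λ σ → qpow (inv′ σ)) (withRecords n k (Sym n)))
  S₁-unfold n k with Sym n
  ... | L with sumP | map {A = List (Fin n)} (λ σ → qpow (inv′ σ))
  ... | s | m = ≡.refl

-- Statistics of words of natural numbers

T⇒≡true : ∀ {b} → T b → b ≡ true
T⇒≡true {true} _ = ≡.refl

¬T⇒≡false : ∀ {b} → ¬ T b → b ≡ false
¬T⇒≡false {true}  ¬t = contradiction _ ¬t
¬T⇒≡false {false} _  = ≡.refl

≤⇒≤ᵇ≡true : ∀ {m n} → m ≤ n → (m ≤ᵇ n) ≡ true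
≤⇒≤ᵇ≡true = T⇒≡true ∘ ℕₚ.≤⇒≤ᵇ

>⇒≤ᵇ≡false : ∀ {m n} → n < m → (m ≤ᵇ n) ≡ false
>⇒≤ᵇ≡false n<m = ¬T⇒≡false (ℕₚ.<⇒≱ n<m ∘ ℕₚ.≤ᵇ⇒≤ _ _)

<⇒<ᵇ≡true : ∀ {m n} → m < n → (m <ᵇ n) ≡ true
<⇒<ᵇ≡true = T⇒≡true ∘ ℕₚ.<⇒<ᵇ

≥⇒<ᵇ≡false : ∀ {m n} → n ≤ m → (m <ᵇ n) ≡ false
≥⇒<ᵇ≡false n≤m = ¬T⇒≡false (ℕₚ.≤⇒≯ n≤m ∘ ℕₚ.<ᵇ⇒< _ _)

≡ᵇ-refl : ∀ n → (n ≡ᵇ n) ≡ true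
≡ᵇ-refl n = T⇒≡true (ℕₚ.≡⇒≡ᵇ n n ≡.refl)

≢⇒≡ᵇ≡false : ∀ {m n} → m ≡.≢ n → (m ≡ᵇ n) ≡ false
≢⇒≡ᵇ≡false m≢n = ¬T⇒≡false (m≢n ∘ ℕₚ.≡ᵇ⇒≡ _ _)

𝟏? : Bool → ℕ
𝟏? b = if b then 1 else 0

count : (ℕ → Bool) → ℕ → ℕ
count P zero    = 0
count P (suc t) = 𝟏? (P t) ℕ.+ count P t

count-cong : ∀ {P Q} t → (∀ v → v < t → P v ≡ Q v) → count P t ≡ count Q t
count-cong zero    eq = ≡.refl
count-cong (suc t) eq = ≡.cong₂ ℕ._+_ (≡.cong 𝟏? (eq t (ℕₚ.n<1+n t)))
  (count-cong t (λ v v<t → eq v (ℕₚ.m<n⇒m<1+n v<t)))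

count-none : ∀ P t → (∀ v → v < t → P v ≡ false) → count P t ≡ 0
count-none P zero    none = ≡.refl
count-none P (suc t) none rewrite none t (ℕₚ.n<1+n t) = count-none P t (λ v v<t → none v (ℕₚ.m<n⇒m<1+n v<t))

count≡0⇒none : ∀ P t → count P t ≡ 0 → ∀ v → v < t → P v ≡ false
count≡0⇒none P (suc t) e v v<1+t with P t in Pt
count≡0⇒none P (suc t) () v v<1+t | true
count≡0⇒none P (suc t) e v v<1+t | false with v ℕ.≟ t
... | yes ≡.refl = Pt
... | no v≢t     = count≡0⇒none P t e v (ℕₚ.≤∧≢⇒< (ℕₚ.≤-pred v<1+t) v≢t)

count-all-above : ∀ P t a → (∀ v → t ≤ v → P v ≡ true) → count P (t ℕ.+ a) ≡ count P t ℕ.+ a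
count-all-above P t zero    above rewrite ℕₚ.+-identityʳ t = ≡.sym (ℕₚ.+-identityʳ _)
count-all-above P t (suc a) above rewrite ℕₚ.+-suc t a | above (t ℕ.+ a) (ℕₚ.m≤m+n t a)
  = ≡.trans (≡.cong suc (count-all-above P t a above)) (≡.sym (ℕₚ.+-suc _ a))

count-remove : ∀ P P′ x → (∀ v → P′ v ≡ P v ∧ not (v ≡ᵇ x)) → ∀ t →
  count P′ t ℕ.+ 𝟏? (P x ∧ (x <ᵇ t)) ≡ count P t
count-remove P P′ x eq zero rewrite 𝔹ₚ.∧-zeroʳ (P x) = ≡.refl
count-remove P P′ x eq (suc t) with t ℕ.≟ x | count-remove P P′ x eq t
... | yes ≡.refl | ih
  rewrite eq t | ≡ᵇ-refl t | 𝔹ₚ.∧-zeroʳ (P t) | ≥⇒<ᵇ≡false (ℕₚ.≤-refl {t})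
        | <⇒<ᵇ≡true (ℕₚ.n<1+n t) | 𝔹ₚ.∧-identityʳ (P t) | 𝔹ₚ.∧-zeroʳ (P t) | ℕₚ.+-identityʳ (count P′ t)
  = ≡.trans (ℕₚ.+-comm _ (𝟏? (P t))) (≡.cong (𝟏? (P t) ℕ.+_) ih)
... | no t≢x | ih
  rewrite eq t | ≢⇒≡ᵇ≡false t≢x | 𝔹ₚ.∧-identityʳ (P t)
  = ≡.trans (ℕₚ.+-assoc (𝟏? (P t)) _ _) (≡.cong (𝟏? (P t) ℕ.+_)
      (≡.trans (≡.cong (λ b → count P′ t ℕ.+ 𝟏? (P x ∧ b)) <ᵇ-suc) ih))
  where
  <ᵇ-suc : (x <ᵇ suc t) ≡ (x <ᵇ t)
  <ᵇ-suc with x ℕ.<? t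
  ... | yes x<t = ≡.trans (<⇒<ᵇ≡true (ℕₚ.m<n⇒m<1+n x<t)) (≡.sym (<⇒<ᵇ≡true x<t))
  ... | no x≮t  = ≡.trans (≥⇒<ᵇ≡false (ℕₚ.≤∧≢⇒< (ℕₚ.≮⇒≥ x≮t) t≢x)) (≡.sym (≥⇒<ᵇ≡false (ℕₚ.≮⇒≥ x≮t)))

used : ℕ → List ℕ → Bool
used v []       = false
used v (y ∷ ys) = (v ≡ᵇ y) ∨ used v ys

free : List ℕ → ℕ → Bool
free ys v = not (used v ys)

distinct : List ℕ → Bool
distinct []       = true
distinct (x ∷ xs) = free xs x ∧ distinct xs

-- One more than the largest letter. The empty word thus has top 0, and a letter is a new maximum
-- exactly when it is at least `top`.
top : List ℕ → ℕ
top []       = 0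
top (y ∷ ys) = suc y ⊔ top ys

records : List ℕ → ℕ
records []       = 0
records (x ∷ xs) = 𝟏? (top xs ≤ᵇ x) ℕ.+ records xs

special′ : ℕ → List ℕ → ℕ
special′ x []       = 0
special′ x (y ∷ ys) = 𝟏? ((y <ᵇ x) ∧ (x <ᵇ top ys)) ℕ.+ special′ x ys

inversions : List ℕ → ℕ
inversions []       = 0
inversions (x ∷ xs) = special′ x xs ℕ.+ inversions xs

below : List ℕ → ℕ
below ys = count (free ys) (top ys)

gap : List ℕ → ℕ → ℕ → ℕ
gap ys w = count (λ v → (w <ᵇ v) ∧ free ys v)

-- The special inversions that the letters not in ys will form with the letters of zs when they are
-- put in front of zs.
pending : List ℕ → List ℕ → ℕ
pending ys []       = 0
pending ys (w ∷ zs) = gap ys w (top zs) ℕ.+ pending ys zs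

potential : List ℕ → ℕ
potential ys = inversions ys ℕ.+ pending ys ys

free-∷ : ∀ x ys v → free (x ∷ ys) v ≡ free ys v ∧ not (v ≡ᵇ x)
free-∷ x ys v with v ≡ᵇ x
... | true  = ≡.sym (𝔹ₚ.∧-zeroʳ (free ys v))
... | false = ≡.sym (𝔹ₚ.∧-identityʳ (free ys v))

gap-∷ : ∀ x ys w t → free ys x ≡ true →
  gap (x ∷ ys) w t ℕ.+ 𝟏? ((w <ᵇ x) ∧ (x <ᵇ t)) ≡ gap ys w t
gap-∷ x ys w t fx = ≡.trans
  (≡.cong (λ b → gap (x ∷ ys) w t ℕ.+ 𝟏? (b ∧ (x <ᵇ t)))
    (≡.sym (≡.trans (≡.cong ((w <ᵇ x) ∧_) fx) (𝔹ₚ.∧-identityʳ (w <ᵇ x)))))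
  (count-remove _ _ x (λ v → ≡.trans (≡.cong ((w <ᵇ v) ∧_) (free-∷ x ys v)) (≡.sym (𝔹ₚ.∧-assoc (w <ᵇ v) (free ys v) _))) t)

-- Placing x only turns pending inversions into actual ones: x leaves the gap of exactly those
-- letters with which it forms a special inversion.
pending-∷ : ∀ x ys zs → free ys x ≡ true → pending (x ∷ ys) zs ℕ.+ special′ x zs ≡ pending ys zs
pending-∷ x ys []       fx = ≡.refl
pending-∷ x ys (w ∷ zs) fx = begin
  (g ℕ.+ p) ℕ.+ (c ℕ.+ s)   ≡⟨ interchange g p c s ⟩
  (g ℕ.+ c) ℕ.+ (p ℕ.+ s)   ≡⟨ ≡.cong₂ ℕ._+_ (gap-∷ x ys w (top zs) fx) (pending-∷ x ys zs fx) ⟩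
  pending ys (w ∷ zs)       ∎
  where
  open ≡.≡-Reasoning
  open CommutativeSemigroupₚ ℕₚ.+-commutativeSemigroup using (interchange)
  g = gap (x ∷ ys) w (top zs)
  p = pending (x ∷ ys) zs
  c = 𝟏? ((w <ᵇ x) ∧ (x <ᵇ top zs))
  s = special′ x zs

-- The inversions of x with letters of `ys` were charged before, so only those in which x will be
-- the smaller letter are new.
potential-∷ : ∀ x ys → free ys x ≡ true → potential (x ∷ ys) ≡ gap ys x (top ys) ℕ.+ potential ys
potential-∷ x ys fx = begin
  (s ℕ.+ i) ℕ.+ (gap (x ∷ ys) x (top ys) ℕ.+ p)
    ≡⟨ ≡.cong (λ g → (s ℕ.+ i) ℕ.+ (g ℕ.+ p)) gap-same ⟩
  (s ℕ.+ i) ℕ.+ (g ℕ.+ p)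
    ≡⟨ solve 4 (λ s i g p → (s :+ i) :+ (g :+ p) := g :+ (i :+ (p :+ s))) ≡.refl s i g p ⟩
  g ℕ.+ (i ℕ.+ (p ℕ.+ s))
    ≡⟨ ≡.cong (λ n → g ℕ.+ (i ℕ.+ n)) (pending-∷ x ys ys fx) ⟩
  g ℕ.+ potential ys ∎
  where
  open ≡.≡-Reasoning
  open +-*-Solver
  s = special′ x ys
  i = inversions ys
  g = gap ys x (top ys)
  p = pending (x ∷ ys) ys
  -- A gap counts values strictly above x, so using up x itself does not change it.
  gap-same : gap (x ∷ ys) x (top ys) ≡ g
  gap-same = ≡.trans (≡.sym (ℕₚ.+-identityʳ _)) (≡.trans
    (≡.cong (λ b → gap (x ∷ ys) x (top ys) ℕ.+ 𝟏? (b ∧ (x <ᵇ top ys))) (≡.sym (≥⇒<ᵇ≡false (ℕₚ.≤-refl {x}))))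
    (gap-∷ x ys x (top ys) fx))

top≤⇒free : ∀ ys v → top ys ≤ v → free ys v ≡ true
top≤⇒free []       v _   = ≡.refl
top≤⇒free (y ∷ ys) v t≤v rewrite ≢⇒≡ᵇ≡false (≡.≢-sym (ℕₚ.<⇒≢ (ℕₚ.m⊔n≤o⇒m≤o (suc y) (top ys) t≤v)))
  = top≤⇒free ys v (ℕₚ.m⊔n≤o⇒n≤o (suc y) (top ys) t≤v)

pending-done : ∀ ys zs → below ys ≡ 0 → top zs ≤ top ys → pending ys zs ≡ 0
pending-done ys []       done _  = ≡.refl
pending-done ys (w ∷ zs) done t≤ = ≡.cong₂ ℕ._+_
  (count-none _ (top zs) (λ v v<t → ≡.trans
    (≡.cong ((w <ᵇ v) ∧_) (count≡0⇒none (free ys) (top ys) done v (ℕₚ.<-≤-trans v<t t≤′))) (𝔹ₚ.∧-zeroʳ (w <ᵇ v))))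
  (pending-done ys zs done t≤′)
  where t≤′ = ℕₚ.m⊔n≤o⇒n≤o (suc w) (top zs) t≤

below-∷-free : ∀ x ys → free ys x ≡ true → x < top ys → suc (below (x ∷ ys)) ≡ below ys
below-∷-free x ys fx x<t = begin
  suc (count (free (x ∷ ys)) (suc x ⊔ top ys))  ≡⟨ ≡.cong (λ t → suc (count (free (x ∷ ys)) t)) (ℕₚ.m≤n⇒m⊔n≡n x<t) ⟩
  suc (count (free (x ∷ ys)) (top ys))          ≡⟨ ℕₚ.+-comm 1 _ ⟩
  count (free (x ∷ ys)) (top ys) ℕ.+ 1          ≡⟨ ≡.cong (λ b → count (free (x ∷ ys)) (top ys) ℕ.+ 𝟏? b) (≡.cong₂ _∧_ fx (<⇒<ᵇ≡true x<t)) ⟨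
  count (free (x ∷ ys)) (top ys) ℕ.+ 𝟏? (free ys x ∧ (x <ᵇ top ys))
    ≡⟨ count-remove (free ys) (free (x ∷ ys)) x (free-∷ x ys) (top ys) ⟩
  below ys                                      ∎
  where open ≡.≡-Reasoning

below-∷-record : ∀ ys a → below ((top ys ℕ.+ a) ∷ ys) ≡ below ys ℕ.+ a
below-∷-record ys a = ℕₚ.suc-injective (begin
  suc (count (free (x ∷ ys)) (suc x ⊔ t))   ≡⟨ ≡.cong (λ t → suc (count (free (x ∷ ys)) t)) (ℕₚ.m≥n⇒m⊔n≡m (ℕₚ.m≤n⇒m≤1+n (ℕₚ.m≤m+n t a))) ⟩
  suc (count (free (x ∷ ys)) (suc x))       ≡⟨ ℕₚ.+-comm 1 _ ⟩
  count (free (x ∷ ys)) (suc x) ℕ.+ 1       ≡⟨ ≡.cong (λ b → count (free (x ∷ ys)) (suc x) ℕ.+ 𝟏? b) (≡.cong₂ _∧_ (top≤⇒free ys x (ℕₚ.m≤m+n t a)) (<⇒<ᵇ≡true (ℕₚ.n<1+n x))) ⟨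
  count (free (x ∷ ys)) (suc x) ℕ.+ 𝟏? (free ys x ∧ (x <ᵇ suc x))
    ≡⟨ count-remove (free ys) (free (x ∷ ys)) x (free-∷ x ys) (suc x) ⟩
  count (free ys) (suc x)                   ≡⟨ ≡.cong (count (free ys)) (ℕₚ.+-suc t a) ⟨
  count (free ys) (t ℕ.+ suc a)             ≡⟨ count-all-above (free ys) t (suc a) (top≤⇒free ys) ⟩
  below ys ℕ.+ suc a                        ≡⟨ ℕₚ.+-suc (below ys) a ⟩
  suc (below ys ℕ.+ a)                      ∎)
  where
  open ≡.≡-Reasoning
  t = top ys
  x = t ℕ.+ a

all-<-top : ∀ {n} (x : Fin n) (ys : List (Fin n)) → all (λ y → toℕ y <ᵇ toℕ x) ys ≡ (top (map toℕ ys) ≤ᵇ toℕ x)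
all-<-top x []       = ≡.refl
all-<-top x (y ∷ ys) = ≡.trans (≡.cong ((toℕ y <ᵇ toℕ x) ∧_) (all-<-top x ys)) (⊔-≤ᵇ (toℕ y) (top (map toℕ ys)) (toℕ x))
  where
  ⊔-≤ᵇ : ∀ y t x → (y <ᵇ x) ∧ (t ≤ᵇ x) ≡ (suc y ⊔ t ≤ᵇ x)
  ⊔-≤ᵇ y t x with y ℕ.<? x | t ℕ.≤? x
  ... | yes y<x | yes t≤x rewrite <⇒<ᵇ≡true y<x | ≤⇒≤ᵇ≡true t≤x = ≡.sym (≤⇒≤ᵇ≡true (ℕₚ.⊔-lub y<x t≤x))
  ... | yes y<x | no t≰x rewrite <⇒<ᵇ≡true y<x | >⇒≤ᵇ≡false (ℕₚ.≰⇒> t≰x)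
    = ≡.sym (>⇒≤ᵇ≡false (ℕₚ.<-≤-trans (ℕₚ.≰⇒> t≰x) (ℕₚ.m≤n⊔m (suc y) t)))
  ... | no y≮x | _ rewrite ≥⇒<ᵇ≡false (ℕₚ.≮⇒≥ y≮x)
    = ≡.sym (>⇒≤ᵇ≡false (ℕₚ.<-≤-trans (s≤s (ℕₚ.≮⇒≥ y≮x)) (ℕₚ.m≤m⊔n (suc y) t)))

-- Comparing x with `top` only says that some letter is at least x; equality is excluded because x
-- does not occur in `ys`.
any->-top : ∀ {n} (x : Fin n) (ys : List (Fin n)) → free (map toℕ ys) (toℕ x) ≡ true →
  any (λ z → toℕ x <ᵇ toℕ z) ys ≡ (toℕ x <ᵇ top (map toℕ ys))
any->-top x []       _  = ≡.refl
any->-top x (y ∷ ys) fx with toℕ x ≡ᵇ toℕ y in x≢y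
... | false = ≡.trans (≡.cong ((toℕ x <ᵇ toℕ y) ∨_) (any->-top x ys fx)) (<ᵇ-⊔ (toℕ y) (top (map toℕ ys)) (toℕ x)
      (λ e → ≡.subst T x≢y (ℕₚ.≡⇒≡ᵇ (toℕ x) (toℕ y) e)))
  where
  <ᵇ-⊔ : ∀ y t x → x ≡.≢ y → (x <ᵇ y) ∨ (x <ᵇ t) ≡ (x <ᵇ suc y ⊔ t)
  <ᵇ-⊔ y t x x≢y with x ℕ.<? y | x ℕ.<? t
  ... | yes x<y | _ rewrite <⇒<ᵇ≡true x<y
    = ≡.sym (<⇒<ᵇ≡true (ℕₚ.<-≤-trans (ℕₚ.m<n⇒m<1+n x<y) (ℕₚ.m≤m⊔n (suc y) t)))
  ... | no x≮y | yes x<t rewrite ≥⇒<ᵇ≡false (ℕₚ.≮⇒≥ x≮y) | <⇒<ᵇ≡true x<t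
    = ≡.sym (<⇒<ᵇ≡true (ℕₚ.<-≤-trans x<t (ℕₚ.m≤n⊔m (suc y) t)))
  ... | no x≮y | no x≮t rewrite ≥⇒<ᵇ≡false (ℕₚ.≮⇒≥ x≮y) | ≥⇒<ᵇ≡false (ℕₚ.≮⇒≥ x≮t)
    = ≡.sym (≥⇒<ᵇ≡false (ℕₚ.⊔-lub (ℕₚ.≤∧≢⇒< (ℕₚ.≮⇒≥ x≮y) (≡.≢-sym x≢y)) (ℕₚ.≮⇒≥ x≮t)))

rlm-records : ∀ {n} (σ : List (Fin n)) → rlm σ ≡ records (map toℕ σ)
rlm-records []      = ≡.refl
rlm-records (x ∷ σ) = ≡.cong₂ (λ b m → 𝟏? b ℕ.+ m) (all-<-top x σ) (rlm-records σ)

special-special′ : ∀ {n} (x : Fin n) (ys : List (Fin n)) → free (map toℕ ys) (toℕ x) ≡ true →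
  special x ys ≡ special′ (toℕ x) (map toℕ ys)
special-special′ x []       _  = ≡.refl
special-special′ x (y ∷ ys) fx with toℕ x ≡ᵇ toℕ y
... | false = ≡.cong₂ (λ b m → 𝟏? ((toℕ y <ᵇ toℕ x) ∧ b) ℕ.+ m) (any->-top x ys fx) (special-special′ x ys fx)

inv′-inversions : ∀ {n} (σ : List (Fin n)) → distinct (map toℕ σ) ≡ true → inv′ σ ≡ inversions (map toℕ σ)
inv′-inversions []      _    = ≡.refl
inv′-inversions (x ∷ σ) dist with free (map toℕ σ) (toℕ x) in fx
... | true = ≡.cong₂ ℕ._+_ (special-special′ x σ fx) (inv′-inversions σ dist)

≟-≡ᵇ : ∀ {n} (x y : Fin n) → does (x Finₚ.≟ y) ≡ (toℕ x ≡ᵇ toℕ y)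
≟-≡ᵇ Fin.zero    Fin.zero    = ≡.refl
≟-≡ᵇ Fin.zero    (Fin.suc y) = ≡.refl
≟-≡ᵇ (Fin.suc x) Fin.zero    = ≡.refl
≟-≡ᵇ (Fin.suc x) (Fin.suc y) = ≟-≡ᵇ x y

unique?-distinct : ∀ {n} (σ : List (Fin n)) → does (UDec.unique? Finₚ._≟_ σ) ≡ distinct (map toℕ σ)
unique?-distinct []      = ≡.refl
unique?-distinct (x ∷ σ) = ≡.cong₂ _∧_ (all?-free σ) (unique?-distinct σ)
  where
  all?-free : ∀ σ → does (All.all? (λ y → ¬? (x Finₚ.≟ y)) σ) ≡ free (map toℕ σ) (toℕ x)
  all?-free []      = ≡.refl
  all?-free (y ∷ σ) = ≡.trans (≡.cong₂ (λ a b → not a ∧ b) (≟-≡ᵇ x y) (all?-free σ)) (≡.sym (not-∨ (toℕ x ≡ᵇ toℕ y) _))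
    where
    not-∨ : ∀ a b → not (a ∨ b) ≡ not a ∧ not b
    not-∨ true  b = ≡.refl
    not-∨ false b = ≡.refl

-- Binomials and q-Pochhammer products in a commutative ring

ℤ-rawRing : RawRing 0ℓ 0ℓ
ℤ-rawRing = CommutativeRing.rawRing ℤₚ.+-*-commutativeRing

-- The ring is kept abstract so that the solver never unfolds coefficient lists; the map from ℤ
-- supplies its constants.
module QAlgebra (R : CommutativeRing 0ℓ 0ℓ)
  (ℤ⟶R : ℤ-rawRing -Raw-AlmostCommutative⟶ fromCommutativeRing R)
  (q : CommutativeRing.Carrier R) where

  open CommutativeRing R hiding (zero)
  open _-Raw-AlmostCommutative⟶_ ℤ⟶R using (⟦_⟧; +-homo; *-homo; -‿homo; 0-homo)
  open import Relation.Binary.Reasoning.Setoid setoid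

  private
    sameCoeff? : (a b : ℤ) → Maybe (⟦ a ⟧ ≈ ⟦ b ⟧)
    sameCoeff? a b with a ℤ.≟ b
    ... | yes ≡.refl = just refl
    ... | no _       = nothing

  open Algebra.Solver.Ring ℤ-rawRing (fromCommutativeRing R) ℤ⟶R sameCoeff?
    using (solve; _:=_; _:+_; _:*_; :-_; _:-_; con)

  -- The values of `con 0ℤ` and `con 1ℤ` in the solver. For polynomials, `𝟘` is the list `0ℤ ∷ []`
  -- while `0#` is `[]`; the two are equal only up to `≈`.
  𝟘 𝟙 : Carrier
  𝟘 = ⟦ 0ℤ ⟧
  𝟙 = ⟦ 1ℤ ⟧

  pow : Carrier → ℕ → Carrier
  pow x zero    = 𝟙
  pow x (suc m) = x * pow x m

  pow-+ : ∀ x m n → pow x (m ℕ.+ n) ≈ pow x m * pow x n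
  pow-+ x zero    n = solve 1 (λ a → a := con 1ℤ :* a) refl (pow x n)
  pow-+ x (suc m) n = trans (*-congˡ (pow-+ x m n))
    (solve 3 (λ a b c → a :* (b :* c) := a :* b :* c) refl x (pow x m) (pow x n))

  1-q^ : ℕ → Carrier
  1-q^ m = 𝟙 - pow q m

  -- The q-shifted factorial (q^(i+1); q)_h, that is (1 - q^(i+1)) ⋯ (1 - q^(i+h)).
  qPoch : ℕ → ℕ → Carrier
  qPoch i zero    = 𝟙
  qPoch i (suc h) = qPoch i h * 1-q^ (i ℕ.+ suc h)

  qPoch-suc : ∀ i h → qPoch i (suc h) ≈ 1-q^ (suc i) * qPoch (suc i) h
  qPoch-suc i zero = trans (*-congˡ (reflexive (≡.cong 1-q^ (≡.trans (ℕₚ.+-suc i 0) (≡.cong suc (ℕₚ.+-identityʳ i))))))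
    (*-comm _ _)
  qPoch-suc i (suc h) = begin
    qPoch i (suc h) * 1-q^ (i ℕ.+ suc (suc h))
      ≈⟨ *-cong (qPoch-suc i h) (reflexive (≡.cong 1-q^ (ℕₚ.+-suc i (suc h)))) ⟩
    1-q^ (suc i) * qPoch (suc i) h * 1-q^ (suc i ℕ.+ suc h)
      ≈⟨ *-assoc _ _ _ ⟩
    1-q^ (suc i) * qPoch (suc i) (suc h) ∎

  qPoch-+ : ∀ s h → qPoch 0 s * qPoch s h ≈ qPoch 0 (s ℕ.+ h)
  qPoch-+ s zero = trans (solve 1 (λ a → a :* con 1ℤ := a) refl (qPoch 0 s))
    (reflexive (≡.cong (qPoch 0) (≡.sym (ℕₚ.+-identityʳ s))))
  qPoch-+ s (suc h) = begin
    qPoch 0 s * (qPoch s h * 1-q^ (s ℕ.+ suc h))  ≈⟨ *-assoc _ _ _ ⟨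
    qPoch 0 s * qPoch s h * 1-q^ (s ℕ.+ suc h)
      ≈⟨ *-cong (qPoch-+ s h) (reflexive (≡.cong 1-q^ (ℕₚ.+-suc s h))) ⟩
    qPoch 0 (suc (s ℕ.+ h))                      ≈⟨ reflexive (≡.cong (qPoch 0) (ℕₚ.+-suc s h)) ⟨
    qPoch 0 (s ℕ.+ suc h)                        ∎

  binom : ℕ → ℕ → Carrier
  binom m       zero    = 𝟙
  binom zero    (suc κ) = 𝟘
  binom (suc m) (suc κ) = binom m κ + binom m (suc κ)

  binom-< : ∀ {m κ} → m < κ → binom m κ ≈ 𝟘
  binom-< {zero}  {suc κ} _         = refl
  binom-< {suc m} {suc κ} (s≤s m<κ) =
    trans (+-cong (binom-< m<κ) (binom-< (ℕₚ.m<n⇒m<1+n m<κ)))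
      (solve 0 (con 0ℤ :+ con 0ℤ := con 0ℤ) refl)

  binom-diag : ∀ κ → binom κ κ ≈ 𝟙
  binom-diag zero    = refl
  binom-diag (suc κ) = trans (+-cong (binom-diag κ) (binom-< (ℕₚ.n<1+n κ)))
    (solve 0 (con 1ℤ :+ con 0ℤ := con 1ℤ) refl)

  -- The image of x^m (1 - x q) ⋯ (1 - x q^i) under the linear map x^m ↦ C(m, κ).
  E : ℕ → ℕ → ℕ → Carrier
  E zero    m κ = binom m κ
  E (suc i) m κ = E i m κ - pow q (suc i) * E i (suc m) κ

  -- `E i m κ` is a Taylor coefficient at x = 1, and x = (x - 1) + 1: multiplication by x - 1 lowers
  -- κ by one. This rule stands in for all algebra in x below.
  E-pascal : ∀ i m κ → E i (suc m) (suc κ) ≈ E i m κ + E i m (suc κ)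
  E-pascal zero    m κ = refl
  E-pascal (suc i) m κ = begin
    E i (suc m) (suc κ) - Q * E i (suc (suc m)) (suc κ)
      ≈⟨ +-cong (E-pascal i m κ) (-‿cong (*-congˡ (E-pascal i (suc m) κ))) ⟩
    (E i m κ + E i m (suc κ)) - Q * (E i (suc m) κ + E i (suc m) (suc κ))
      ≈⟨ solve 5 (λ a b c d Q → (a :+ b) :- Q :* (c :+ d) := (a :- Q :* c) :+ (b :- Q :* d)) refl
           (E i m κ) (E i m (suc κ)) (E i (suc m) κ) (E i (suc m) (suc κ)) Q ⟩
    E (suc i) m κ + E (suc i) m (suc κ) ∎
    where Q = pow q (suc i)

  E-at-one : ∀ i m → E i m 0 ≈ qPoch 0 i
  E-at-one zero    m = refl
  E-at-one (suc i) m = trans (+-cong (E-at-one i m) (-‿cong (*-congˡ (E-at-one i (suc m)))))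
    (solve 2 (λ a b → a :- b :* a := a :* (con 1ℤ :- b)) refl (qPoch 0 i) (pow q (suc i)))

  -- Power series in t as coefficient sequences

  Seq : Set
  Seq = ℕ → Carrier

  infix 4 _≋_
  _≋_ : Seq → Seq → Set
  u ≋ v = ∀ i → u i ≈ v i

  shift : Seq → Seq
  shift u zero    = 𝟘
  shift u (suc i) = u i

  -- The coefficient sequence of (1 - t)^{-c} times the generating function of u.
  prefix : ℕ → Seq → Seq
  prefix zero    u i       = u i
  prefix (suc c) u zero    = prefix c u zero
  prefix (suc c) u (suc i) = prefix (suc c) u i + prefix c u (suc i)

  prefix-cong : ∀ c {u v} → u ≋ v → prefix c u ≋ prefix c v
  prefix-cong zero    eq i       = eq i
  prefix-cong (suc c) eq zero    = prefix-cong c eq zero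
  prefix-cong (suc c) eq (suc i) = +-cong (prefix-cong (suc c) eq i) (prefix-cong c eq (suc i))

  prefix-+ : ∀ c u v → prefix c (λ i → u i + v i) ≋ λ i → prefix c u i + prefix c v i
  prefix-+ zero    u v i       = refl
  prefix-+ (suc c) u v zero    = prefix-+ c u v zero
  prefix-+ (suc c) u v (suc i) = trans (+-cong (prefix-+ (suc c) u v i) (prefix-+ c u v (suc i)))
    (solve 4 (λ a b c d → (a :+ b) :+ (c :+ d) := (a :+ c) :+ (b :+ d)) refl
      (prefix (suc c) u i) (prefix (suc c) v i) (prefix c u (suc i)) (prefix c v (suc i)))

  prefix-* : ∀ c a u → prefix c (λ i → a * u i) ≋ λ i → a * prefix c u i
  prefix-* zero    a u i       = refl
  prefix-* (suc c) a u zero    = prefix-* c a u zero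
  prefix-* (suc c) a u (suc i) =
    trans (+-cong (prefix-* (suc c) a u i) (prefix-* c a u (suc i))) (sym (distribˡ a _ _))

  prefix-shift : ∀ c u → prefix c (shift u) ≋ shift (prefix c u)
  prefix-shift zero    u i       = refl
  prefix-shift (suc c) u zero    = prefix-shift c u zero
  prefix-shift (suc c) u (suc zero) = trans
    (+-cong (prefix-shift (suc c) u zero) (prefix-shift c u (suc zero)))
    (solve 1 (λ a → con 0ℤ :+ a := a) refl (prefix c u zero))
  prefix-shift (suc c) u (suc (suc i)) =
    +-cong (prefix-shift (suc c) u (suc i)) (prefix-shift c u (suc (suc i)))

  prefix-unfold : ∀ c u i → prefix (suc c) u i ≈ shift (prefix (suc c) u) i + prefix c u i
  prefix-unfold c u zero    = solve 1 (λ a → a := con 0ℤ :+ a) refl (prefix c u zero)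
  prefix-unfold c u (suc i) = refl

  δ₀ : Seq
  δ₀ zero    = 𝟙
  δ₀ (suc _) = 𝟘

  prefix-δ₀ : ∀ κ s → prefix (suc κ) δ₀ s ≈ binom (s ℕ.+ κ) κ
  prefix-δ₀ zero    zero    = refl
  prefix-δ₀ zero    (suc s) = trans (+-congʳ (prefix-δ₀ zero s))
    (solve 0 (con 1ℤ :+ con 0ℤ := con 1ℤ) refl)
  prefix-δ₀ (suc κ) zero    = trans (prefix-δ₀ κ zero) (trans (binom-diag κ) (sym (binom-diag (suc κ))))
  prefix-δ₀ (suc κ) (suc s) = trans (+-comm _ _) (+-cong
    (trans (prefix-δ₀ κ (suc s)) (reflexive (≡.cong (λ m → binom m κ) (≡.sym (ℕₚ.+-suc s κ)))))
    (prefix-δ₀ (suc κ) s))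

  -- The eigenfunction of the header with t x replaced by t and x^h by x^m, then mapped to its
  -- coefficient of (x - 1)^κ.
  term : ℕ → ℕ → ℕ → Seq
  term m κ h i = E i m κ * qPoch i h

  -- The three-term relation of the continuous big q-Hermite polynomials, read off at t^i.
  term-relation : ∀ m κ h i →
    term (suc m) (suc κ) (suc h) i + 1-q^ (suc h) * shift (term m (suc κ) (suc h)) i
      + shift (term m κ (suc h)) i
    ≈ term m κ (suc h) i + shift (term (suc m) (suc κ) (suc (suc h))) i
      + 1-q^ (suc h) * term m (suc κ) h i
  term-relation m κ h zero = trans (+-congʳ (+-congʳ (*-congʳ (E-pascal 0 m κ))))
    (solve 4 (λ a b f Q → (a :+ b) :* (f :* Q) :+ Q :* con 0ℤ :+ con 0ℤ
                       := a :* (f :* Q) :+ con 0ℤ :+ Q :* (b :* f)) refl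
      (binom m κ) (binom m (suc κ)) (qPoch 0 h) (1-q^ (suc h)))
  term-relation m κ h (suc j) = begin
    -- Every Pochhammer product is a multiple of `F`, and by `E-pascal` every value of `E` is a
    -- combination of `d`, `e` and `g`; what remains is polynomial in `Qi` and `Qh`.
    e₁ * (F * 1-q^ (suc j ℕ.+ suc h)) + (𝟙 - Qh) * (E j m (suc κ) * qPoch j (suc h))
      + E j m κ * qPoch j (suc h)
      ≈⟨ +-cong (+-cong (*-cong (E-pascal (suc j) m κ) (*-congˡ split))
                        (*-congˡ (*-congˡ (qPoch-suc j h))))
                (*-congˡ (qPoch-suc j h)) ⟩
    ((d - Qi * g) + (e - Qi * e′)) * (F * (𝟙 - Qi * Qh)) + (𝟙 - Qh) * (e * ((𝟙 - Qi) * F)) + d * ((𝟙 - Qi) * F)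
      ≈⟨ +-congʳ (+-congʳ (*-congʳ (+-congˡ (+-congˡ (-‿cong (*-congˡ (E-pascal j m κ))))))) ⟩
    ((d - Qi * g) + (e - Qi * (d + e))) * (F * (𝟙 - Qi * Qh)) + (𝟙 - Qh) * (e * ((𝟙 - Qi) * F)) + d * ((𝟙 - Qi) * F)
      ≈⟨ solve 6 (λ d e g Qi Qh F →
           ((d :- Qi :* g) :+ (e :- Qi :* (d :+ e))) :* (F :* (con 1ℤ :- Qi :* Qh))
             :+ (con 1ℤ :- Qh) :* (e :* ((con 1ℤ :- Qi) :* F)) :+ d :* ((con 1ℤ :- Qi) :* F)
           := (d :- Qi :* g) :* (F :* (con 1ℤ :- Qi :* Qh))
             :+ (d :+ e) :* (((con 1ℤ :- Qi) :* F) :* (con 1ℤ :- Qi :* Qh))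
             :+ (con 1ℤ :- Qh) :* ((e :- Qi :* (d :+ e)) :* F)) refl d e g Qi Qh F ⟩
    (d - Qi * g) * (F * (𝟙 - Qi * Qh)) + (d + e) * (((𝟙 - Qi) * F) * (𝟙 - Qi * Qh))
      + (𝟙 - Qh) * ((e - Qi * (d + e)) * F)
      ≈⟨ +-cong (+-cong (*-congˡ (*-congˡ split))
                        (*-cong (E-pascal j m κ) (*-cong (qPoch-suc j h) split′)))
                (*-congˡ (*-congʳ (+-congˡ (-‿cong (*-congˡ (E-pascal j m κ)))))) ⟨
    E (suc j) m κ * (F * 1-q^ (suc j ℕ.+ suc h)) + e′ * (qPoch j (suc h) * 1-q^ (j ℕ.+ suc (suc h)))
      + (𝟙 - Qh) * (E (suc j) m (suc κ) * F) ∎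
    where
    F  = qPoch (suc j) h
    Qi = pow q (suc j)
    Qh = pow q (suc h)
    d  = E j m κ
    e  = E j m (suc κ)
    e′ = E j (suc m) (suc κ)
    g  = E j (suc m) κ
    e₁ = E (suc j) (suc m) (suc κ)
    split : 1-q^ (suc j ℕ.+ suc h) ≈ 𝟙 - Qi * Qh
    split = +-congˡ (-‿cong (pow-+ q (suc j) (suc h)))
    split′ : 1-q^ (j ℕ.+ suc (suc h)) ≈ 𝟙 - Qi * Qh
    split′ = trans (reflexive (≡.cong 1-q^ (ℕₚ.+-suc j (suc h)))) split

  -- At h = 0 the factor 1 - q^h removes two terms of the relation. The last summand is the
  -- inhomogeneous term of the boundary equation: it is x^m before the Taylor coefficient is taken,
  -- and sits at t^0 only.
  term-relation₀ : ∀ m κ i →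
    term (suc m) (suc κ) 0 i + shift (term m κ 0) i
    ≈ term m κ 0 i + shift (term (suc m) (suc κ) 1) i + binom m (suc κ) * δ₀ i
  term-relation₀ m κ zero =
    solve 2 (λ a b → (a :+ b) :* con 1ℤ :+ con 0ℤ := a :* con 1ℤ :+ con 0ℤ :+ b :* con 1ℤ) refl
      (binom m κ) (binom m (suc κ))
  term-relation₀ m κ (suc j) = begin
    E (suc j) (suc m) (suc κ) * 𝟙 + d * 𝟙
      ≈⟨ +-congʳ (*-congʳ (trans (E-pascal (suc j) m κ) (+-congˡ (+-congˡ (-‿cong (*-congˡ (E-pascal j m κ))))))) ⟩
    ((d - Q * g) + (e - Q * (d + e))) * 𝟙 + d * 𝟙
      ≈⟨ solve 5 (λ d e g b Q →
           ((d :- Q :* g) :+ (e :- Q :* (d :+ e))) :* con 1ℤ :+ d :* con 1ℤ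
           := (d :- Q :* g) :* con 1ℤ :+ (d :+ e) :* (con 1ℤ :* (con 1ℤ :- Q)) :+ b :* con 0ℤ) refl d e g (binom m (suc κ)) Q ⟩
    (d - Q * g) * 𝟙 + (d + e) * (𝟙 * (𝟙 - Q)) + binom m (suc κ) * 𝟘
      ≈⟨ +-congʳ (+-congˡ (*-cong (E-pascal j m κ)
           (*-congˡ (reflexive (≡.cong 1-q^ (ℕₚ.+-comm j 1)))))) ⟨
    E (suc j) m κ * 𝟙 + E j (suc m) (suc κ) * (𝟙 * 1-q^ (j ℕ.+ 1)) + binom m (suc κ) * 𝟘 ∎
    where
    Q = pow q (suc j)
    d = E j m κ
    e = E j m (suc κ)
    g = E j (suc m) κ

  private
    +-cancelʳ : ∀ {x y} z → x + z ≈ y + z → x ≈ y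
    +-cancelʳ {x} {y} z eq = begin
      x            ≈⟨ solve 2 (λ x z → x := (x :+ z) :- z) refl x z ⟩
      (x + z) - z  ≈⟨ +-congʳ eq ⟩
      (y + z) - z  ≈⟨ solve 2 (λ y z → (y :+ z) :- z := y) refl y z ⟩
      y            ∎

  shift-cong : ∀ {u v} → u ≋ v → shift u ≋ shift v
  shift-cong eq zero    = refl
  shift-cong eq (suc i) = eq i

  -- The prefix sums supply the factor (1 - t x)^(-κ-1) of z^(-κ-1), again with t x replaced by t; κ
  -- is both the order of the Taylor coefficient and the order of the sums.
  conv : ℕ → ℕ → ℕ → Seq
  conv m κ h = prefix (suc κ) (term m κ h)

  -- All series are summed κ + 2 times. The series with index κ needs one summation less; it occurs
  -- on the right plain and on the left times t, and the resulting factor 1 - t removes one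
  -- summation.
  conv-relation : ∀ m κ h s →
    conv (suc m) (suc κ) (suc h) s + 1-q^ (suc h) * shift (conv m (suc κ) (suc h)) s
    ≈ conv m κ (suc h) s + shift (conv (suc m) (suc κ) (suc (suc h))) s
      + 1-q^ (suc h) * conv m (suc κ) h s
  conv-relation m κ h s = +-cancelʳ (shift P s) (begin
    conv (suc m) (suc κ) (suc h) s + a * shift (conv m (suc κ) (suc h)) s + shift P s
      ≈⟨ +-cong (+-congˡ (*-congˡ (prefix-shift c u₂ s))) (prefix-shift c u₃ s) ⟨
    prefix c u₁ s + a * prefix c (shift u₂) s + prefix c (shift u₃) s
      ≈⟨ +-congʳ (+-congˡ (prefix-* c a (shift u₂) s)) ⟨
    prefix c u₁ s + prefix c (λ i → a * shift u₂ i) s + prefix c (shift u₃) s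
      ≈⟨ prefix-+₃ u₁ (λ i → a * shift u₂ i) (shift u₃) ⟨
    prefix c (λ i → u₁ i + a * shift u₂ i + shift u₃ i) s
      ≈⟨ prefix-cong c (term-relation m κ h) s ⟩
    prefix c (λ i → u₃ i + shift u₄ i + a * u₅ i) s
      ≈⟨ prefix-+₃ u₃ (shift u₄) (λ i → a * u₅ i) ⟩
    P s + prefix c (shift u₄) s + prefix c (λ i → a * u₅ i) s
      ≈⟨ +-cong (+-cong (prefix-unfold (suc κ) u₃ s) (prefix-shift c u₄ s)) (prefix-* c a u₅ s) ⟩
    (shift P s + conv m κ (suc h) s) + shift (conv (suc m) (suc κ) (suc (suc h))) s
      + a * conv m (suc κ) h s
      ≈⟨ solve 4 (λ p x y z → (p :+ x) :+ y :+ z := (x :+ y :+ z) :+ p) refl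
           (shift P s) (conv m κ (suc h) s) (shift (conv (suc m) (suc κ) (suc (suc h))) s)
           (a * conv m (suc κ) h s) ⟩
    (conv m κ (suc h) s + shift (conv (suc m) (suc κ) (suc (suc h))) s
      + a * conv m (suc κ) h s) + shift P s ∎)
    where
    a  = 1-q^ (suc h)
    c  = suc (suc κ)
    u₁ = term (suc m) (suc κ) (suc h)
    u₂ = term m (suc κ) (suc h)
    u₃ = term m κ (suc h)
    u₄ = term (suc m) (suc κ) (suc (suc h))
    u₅ = term m (suc κ) h
    P  = prefix c u₃
    prefix-+₃ : ∀ u v w → prefix c (λ i → u i + v i + w i) s ≈ prefix c u s + prefix c v s + prefix c w s
    prefix-+₃ u v w = trans (prefix-+ c (λ i → u i + v i) w s) (+-congʳ (prefix-+ c u v s))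

  conv-relation₀ : ∀ m κ s →
    conv (suc m) (suc κ) 0 s
    ≈ conv m κ 0 s + shift (conv (suc m) (suc κ) 1) s
      + binom m (suc κ) * binom (s ℕ.+ suc κ) (suc κ)
  conv-relation₀ m κ s = +-cancelʳ (shift P s) (begin
    conv (suc m) (suc κ) 0 s + shift P s
      ≈⟨ +-congˡ (prefix-shift c u₃ s) ⟨
    prefix c u₁ s + prefix c (shift u₃) s
      ≈⟨ prefix-+ c u₁ (shift u₃) s ⟨
    prefix c (λ i → u₁ i + shift u₃ i) s
      ≈⟨ prefix-cong c (term-relation₀ m κ) s ⟩
    prefix c (λ i → u₃ i + shift u₄ i + b * δ₀ i) s
      ≈⟨ trans (prefix-+ c (λ i → u₃ i + shift u₄ i) (λ i → b * δ₀ i) s) (+-congʳ (prefix-+ c u₃ (shift u₄) s)) ⟩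
    P s + prefix c (shift u₄) s + prefix c (λ i → b * δ₀ i) s
      ≈⟨ +-cong (+-cong (prefix-unfold (suc κ) u₃ s) (prefix-shift c u₄ s))
           (trans (prefix-* c b δ₀ s) (*-congˡ (prefix-δ₀ (suc κ) s))) ⟩
    (shift P s + conv m κ 0 s) + shift (conv (suc m) (suc κ) 1) s + b * binom (s ℕ.+ suc κ) (suc κ)
      ≈⟨ solve 4 (λ p x y z → (p :+ x) :+ y :+ z := (x :+ y :+ z) :+ p) refl
           (shift P s) (conv m κ 0 s) (shift (conv (suc m) (suc κ) 1) s)
           (b * binom (s ℕ.+ suc κ) (suc κ)) ⟩
    (conv m κ 0 s + shift (conv (suc m) (suc κ) 1) s + b * binom (s ℕ.+ suc κ) (suc κ)) + shift P s ∎)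
    where
    b  = binom m (suc κ)
    c  = suc (suc κ)
    u₁ = term (suc m) (suc κ) 0
    u₃ = term m κ 0
    u₄ = term (suc m) (suc κ) 1
    P  = prefix c u₃

  -- The closed form of rise: the residue at x = 1 described in the header.
  closed : ℕ → ℕ → Seq
  closed κ h s = conv (s ℕ.+ (h ℕ.+ κ)) κ h s - shift (conv (suc (s ℕ.+ (h ℕ.+ κ))) κ h) s

  private
    conv-m : ∀ {m m′} κ h s → m ≡ m′ → conv m κ h s ≈ conv m′ κ h s
    conv-m κ h s ≡.refl = refl

  -- The two halves of `closed` obey `conv-relation` separately: a further factor t comes with a
  -- further x, so the second half uses it with m one larger and s one smaller.
  closed-relation : ∀ κ h s →
    closed (suc κ) (suc h) s + 1-q^ (suc h) * shift (closed (suc κ) (suc h)) s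
    ≈ closed κ (suc h) s + shift (closed (suc κ) (suc (suc h))) s
      + 1-q^ (suc h) * closed (suc κ) h s
  closed-relation κ h zero = begin
    (conv (suc (h ℕ.+ suc κ)) (suc κ) (suc h) 0 - 𝟘) + a * 𝟘
      ≈⟨ +-congʳ (+-congʳ (conv-m (suc κ) (suc h) 0 (≡.cong suc (ℕₚ.+-suc h κ)))) ⟩
    (conv (suc M) (suc κ) (suc h) 0 - 𝟘) + a * 𝟘
      ≈⟨ solve 2 (λ x a → (x :- con 0ℤ) :+ a :* con 0ℤ := x :+ a :* con 0ℤ) refl
           (conv (suc M) (suc κ) (suc h) 0) a ⟩
    conv (suc M) (suc κ) (suc h) 0 + a * 𝟘
      ≈⟨ conv-relation M κ h 0 ⟩
    conv M κ (suc h) 0 + 𝟘 + a * conv M (suc κ) h 0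
      ≈⟨ +-congˡ (*-congˡ (conv-m (suc κ) h 0 (≡.sym (ℕₚ.+-suc h κ)))) ⟩
    conv M κ (suc h) 0 + 𝟘 + a * conv (h ℕ.+ suc κ) (suc κ) h 0
      ≈⟨ solve 3 (λ x y a → x :+ con 0ℤ :+ a :* y := (x :- con 0ℤ) :+ con 0ℤ :+ a :* (y :- con 0ℤ)) refl
           (conv M κ (suc h) 0) (conv (h ℕ.+ suc κ) (suc κ) h 0) a ⟩
    (conv M κ (suc h) 0 - 𝟘) + 𝟘 + a * (conv (h ℕ.+ suc κ) (suc κ) h 0 - 𝟘) ∎
    where
    a = 1-q^ (suc h)
    M = suc h ℕ.+ κ
  closed-relation κ h (suc s) = begin
    (conv (suc s ℕ.+ (suc h ℕ.+ suc κ)) (suc κ) (suc h) (suc s)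
      - conv (suc (suc s ℕ.+ (suc h ℕ.+ suc κ))) (suc κ) (suc h) s)
    + a * (conv (s ℕ.+ (suc h ℕ.+ suc κ)) (suc κ) (suc h) s
      - shift (conv (suc (s ℕ.+ (suc h ℕ.+ suc κ))) (suc κ) (suc h)) s)
      ≈⟨ +-cong (+-cong (conv-m (suc κ) (suc h) (suc s) (≡.cong suc e)) (-‿cong (conv-m (suc κ) (suc h) s (≡.cong (λ n → suc (suc n)) e))))
           (*-congˡ (+-cong (conv-m (suc κ) (suc h) s e) (-‿cong (shift-cong (λ i → conv-m (suc κ) (suc h) i (≡.cong suc e)) s)))) ⟩
    (conv (suc M) (suc κ) (suc h) (suc s) - conv (suc (suc M)) (suc κ) (suc h) s)
      + a * (conv M (suc κ) (suc h) s - shift (conv (suc M) (suc κ) (suc h)) s)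
      ≈⟨ solve 5 (λ x y z w a → (x :- y) :+ a :* (z :- w) := (x :+ a :* z) :- (y :+ a :* w)) refl
           (conv (suc M) (suc κ) (suc h) (suc s)) (conv (suc (suc M)) (suc κ) (suc h) s)
           (conv M (suc κ) (suc h) s) (shift (conv (suc M) (suc κ) (suc h)) s) a ⟩
    (conv (suc M) (suc κ) (suc h) (suc s) + a * conv M (suc κ) (suc h) s)
      - (conv (suc (suc M)) (suc κ) (suc h) s + a * shift (conv (suc M) (suc κ) (suc h)) s)
      ≈⟨ +-cong (conv-relation M κ h (suc s)) (-‿cong (conv-relation (suc M) κ h s)) ⟩
    (conv M κ (suc h) (suc s) + conv (suc M) (suc κ) (suc (suc h)) s + a * conv M (suc κ) h (suc s))
      - (conv (suc M) κ (suc h) s + shift (conv (suc (suc M)) (suc κ) (suc (suc h))) s + a * conv (suc M) (suc κ) h s)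
      ≈⟨ solve 7 (λ x₁ x₂ x₃ y₁ y₂ y₃ a → (x₁ :+ x₂ :+ a :* x₃) :- (y₁ :+ y₂ :+ a :* y₃)
           := (x₁ :- y₁) :+ (x₂ :- y₂) :+ a :* (x₃ :- y₃)) refl
           (conv M κ (suc h) (suc s)) (conv (suc M) (suc κ) (suc (suc h)) s) (conv M (suc κ) h (suc s))
           (conv (suc M) κ (suc h) s) (shift (conv (suc (suc M)) (suc κ) (suc (suc h))) s) (conv (suc M) (suc κ) h s) a ⟩
    (conv M κ (suc h) (suc s) - conv (suc M) κ (suc h) s)
      + (conv (suc M) (suc κ) (suc (suc h)) s - shift (conv (suc (suc M)) (suc κ) (suc (suc h))) s)
      + a * (conv M (suc κ) h (suc s) - conv (suc M) (suc κ) h s)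
      ≈⟨ +-cong (+-congˡ (+-cong (conv-m (suc κ) (suc (suc h)) s e₂) (-‿cong (shift-cong (λ i → conv-m (suc κ) (suc (suc h)) i (≡.cong suc e₂)) s))))
           (*-congˡ (+-cong (conv-m (suc κ) h (suc s) e₃) (-‿cong (conv-m (suc κ) h s (≡.cong suc e₃))))) ⟩
    closed κ (suc h) (suc s) + closed (suc κ) (suc (suc h)) s + a * closed (suc κ) h (suc s) ∎
    where
    a = 1-q^ (suc h)
    M = suc s ℕ.+ (suc h ℕ.+ κ)
    e : s ℕ.+ (suc h ℕ.+ suc κ) ≡ M
    e = ≡.trans (≡.cong (s ℕ.+_) (≡.cong suc (ℕₚ.+-suc h κ))) (ℕₚ.+-suc s (suc h ℕ.+ κ))
    e₂ : suc M ≡ s ℕ.+ (suc (suc h) ℕ.+ suc κ)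
    e₂ = ≡.trans (≡.cong suc (≡.sym e)) (≡.sym (ℕₚ.+-suc s (suc h ℕ.+ suc κ)))
    e₃ : M ≡ suc s ℕ.+ (h ℕ.+ suc κ)
    e₃ = ≡.cong (suc s ℕ.+_) (≡.sym (ℕₚ.+-suc h κ))

  -- The inhomogeneous terms of the two halves are b c and c b and cancel. Together they are the
  -- residue of z^(-κ-2) dz, an exact differential; only at exponent -1, that is for the index 0,
  -- would a residue survive.
  closed-relation₀ : ∀ κ s →
    closed (suc κ) 0 s ≈ closed κ 0 s + shift (closed (suc κ) 1) s
  closed-relation₀ κ zero = begin
    conv (suc κ) (suc κ) 0 0 - 𝟘
      ≈⟨ +-congʳ (conv-relation₀ κ κ 0) ⟩
    (conv κ κ 0 0 + 𝟘 + binom κ (suc κ) * binom (suc κ) (suc κ)) - 𝟘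
      ≈⟨ +-congʳ (+-congˡ (*-congʳ (binom-< (ℕₚ.n<1+n κ)))) ⟩
    (conv κ κ 0 0 + 𝟘 + 𝟘 * binom (suc κ) (suc κ)) - 𝟘
      ≈⟨ solve 2 (λ x b → (x :+ con 0ℤ :+ con 0ℤ :* b) :- con 0ℤ := (x :- con 0ℤ) :+ con 0ℤ) refl
           (conv κ κ 0 0) (binom (suc κ) (suc κ)) ⟩
    (conv κ κ 0 0 - 𝟘) + 𝟘 ∎
  closed-relation₀ κ (suc s) = begin
    conv (suc (s ℕ.+ suc κ)) (suc κ) 0 (suc s) - conv (suc (suc (s ℕ.+ suc κ))) (suc κ) 0 s
      ≈⟨ +-cong (conv-m (suc κ) 0 (suc s) (≡.cong suc e)) (-‿cong (conv-m (suc κ) 0 s (≡.cong (λ n → suc (suc n)) e))) ⟩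
    conv (suc M) (suc κ) 0 (suc s) - conv (suc (suc M)) (suc κ) 0 s
      ≈⟨ +-cong (conv-relation₀ M κ (suc s)) (-‿cong (conv-relation₀ (suc M) κ s)) ⟩
    (conv M κ 0 (suc s) + conv (suc M) (suc κ) 1 s + binom M (suc κ) * binom (suc (s ℕ.+ suc κ)) (suc κ))
      - (conv (suc M) κ 0 s + shift (conv (suc (suc M)) (suc κ) 1) s + binom (suc M) (suc κ) * binom (s ℕ.+ suc κ) (suc κ))
      ≈⟨ +-cong (+-congˡ (*-congˡ (reflexive (≡.cong (λ n → binom (suc n) (suc κ)) e))))
           (-‿cong (+-congˡ (*-congˡ (reflexive (≡.cong (λ n → binom n (suc κ)) e))))) ⟩
    (conv M κ 0 (suc s) + conv (suc M) (suc κ) 1 s + binom M (suc κ) * binom (suc M) (suc κ))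
      - (conv (suc M) κ 0 s + shift (conv (suc (suc M)) (suc κ) 1) s + binom (suc M) (suc κ) * binom M (suc κ))
      ≈⟨ solve 6 (λ x₁ x₂ y₁ y₂ b c → (x₁ :+ x₂ :+ b :* c) :- (y₁ :+ y₂ :+ c :* b)
           := (x₁ :- y₁) :+ (x₂ :- y₂)) refl
           (conv M κ 0 (suc s)) (conv (suc M) (suc κ) 1 s)
           (conv (suc M) κ 0 s) (shift (conv (suc (suc M)) (suc κ) 1) s) (binom M (suc κ)) (binom (suc M) (suc κ)) ⟩
    (conv M κ 0 (suc s) - conv (suc M) κ 0 s)
      + (conv (suc M) (suc κ) 1 s - shift (conv (suc (suc M)) (suc κ) 1) s)
      ≈⟨ +-congˡ (+-cong (conv-m (suc κ) 1 s e₂) (-‿cong (shift-cong (λ i → conv-m (suc κ) 1 i (≡.cong suc e₂)) s))) ⟩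
    closed κ 0 (suc s) + closed (suc κ) 1 s ∎
    where
    M = suc (s ℕ.+ κ)
    e : s ℕ.+ suc κ ≡ M
    e = ℕₚ.+-suc s κ
    e₂ : suc M ≡ s ℕ.+ (1 ℕ.+ suc κ)
    e₂ = ≡.trans (≡.cong suc (≡.sym e)) (≡.sym (ℕₚ.+-suc s (suc κ)))

  -- walk κ h s is (1 - q)^(h + s) times the q-count of the completions with κ further records, when
  -- κ + s unused values lie above the maximum and h below it; rise is the part that begins with a record.
  mutual
    walk : ℕ → ℕ → Seq
    walk zero    h       zero    = qPoch 0 h
    walk zero    h       (suc s) = 𝟘
    walk (suc κ) zero    s       = rise κ zero s
    walk (suc κ) (suc h) s       = 1-q^ (suc h) * walk (suc κ) h s + rise κ (suc h) s

    rise : ℕ → ℕ → Seq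
    rise κ h zero    = walk κ h zero
    rise κ h (suc s) = walk κ h (suc s) + rise κ (suc h) s

  rise₀ : ∀ h s → rise 0 h s ≈ qPoch 0 (s ℕ.+ h)
  rise₀ h zero    = refl
  rise₀ h (suc s) = trans (+-congˡ (rise₀ (suc h) s))
    (trans (solve 1 (λ a → con 0ℤ :+ a := a) refl _) (reflexive (≡.cong (qPoch 0) (ℕₚ.+-suc s h))))

  -- For κ = 0 the residue is the value at x = 1, where the exponent m has no effect; the two halves
  -- then differ by the factor t and telescope.
  closed₀ : ∀ h s → closed 0 h s ≈ qPoch 0 (s ℕ.+ h)
  closed₀ h s = begin
    conv (s ℕ.+ (h ℕ.+ 0)) 0 h s - shift (conv (suc (s ℕ.+ (h ℕ.+ 0))) 0 h) s
      ≈⟨ +-cong (conv₀ _ s) (-‿cong (shift-cong (conv₀ _) s)) ⟩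
    prefix 1 v s - shift (prefix 1 v) s
      ≈⟨ +-congʳ (prefix-unfold 0 v s) ⟩
    (shift (prefix 1 v) s + v s) - shift (prefix 1 v) s
      ≈⟨ solve 2 (λ a b → (a :+ b) :- a := b) refl (shift (prefix 1 v) s) (v s) ⟩
    v s ∎
    where
    v : Seq
    v i = qPoch 0 (i ℕ.+ h)
    conv₀ : ∀ m → conv m 0 h ≋ prefix 1 v
    conv₀ m = prefix-cong 1 (λ i → trans (*-congʳ (E-at-one i m)) (qPoch-+ i h))

  mutual
    -- The definition of `rise` solved for `walk`. With this substitution the recursion of `walk`
    -- becomes `closed-relation`, the eigenvalue equation.
    walk-closed : ∀ κ h s → walk (suc κ) h s ≈ closed (suc κ) h s - shift (closed (suc κ) (suc h)) s
    walk-closed κ zero s = begin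
      rise κ zero s            ≈⟨ rise-closed κ zero s ⟩
      closed κ zero s
        ≈⟨ solve 2 (λ a b → a := (a :+ b) :- b) refl (closed κ zero s) (shift (closed (suc κ) 1) s) ⟩
      (closed κ zero s + shift (closed (suc κ) 1) s) - shift (closed (suc κ) 1) s
        ≈⟨ +-congʳ (closed-relation₀ κ s) ⟨
      closed (suc κ) zero s - shift (closed (suc κ) 1) s ∎
    walk-closed κ (suc h) s = begin
      a * walk (suc κ) h s + rise κ (suc h) s
        ≈⟨ +-cong (*-congˡ (walk-closed κ h s)) (rise-closed κ (suc h) s) ⟩
      a * (x - y) + z
        ≈⟨ solve 5 (λ a x y z w → a :* (x :- y) :+ z := ((z :+ w :+ a :* x) :- a :* y) :- w) refl a x y z w ⟩
      ((z + w + a * x) - a * y) - w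
        ≈⟨ +-congʳ (+-congʳ (closed-relation κ h s)) ⟨
      ((v + a * y) - a * y) - w
        ≈⟨ solve 3 (λ v y w → ((v :+ y) :- y) :- w := v :- w) refl v (a * y) w ⟩
      v - w ∎
      where
      a = 1-q^ (suc h)
      x = closed (suc κ) h s
      y = shift (closed (suc κ) (suc h)) s
      z = closed κ (suc h) s
      w = shift (closed (suc κ) (suc (suc h))) s
      v = closed (suc κ) (suc h) s

    rise-closed : ∀ κ h s → rise κ h s ≈ closed κ h s
    rise-closed zero    h s       = trans (rise₀ h s) (sym (closed₀ h s))
    rise-closed (suc κ) h zero    = trans (walk-closed κ h zero)
      (solve 1 (λ a → a :- con 0ℤ := a) refl (closed (suc κ) h zero))
    rise-closed (suc κ) h (suc s) = trans (+-cong (walk-closed κ h (suc s)) (rise-closed (suc κ) (suc h) s))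
      (solve 2 (λ a b → (a :- b) :+ b := a) refl (closed (suc κ) h (suc s)) (closed (suc κ) (suc h) s))

  -- Finite sums and the expansion of the closed form at h = 0

  Σ< : ℕ → Seq → Carrier
  Σ< zero    u = 𝟘
  Σ< (suc n) u = Σ< n u + u n

  Σ<-cong : ∀ n {u v} → (∀ i → i < n → u i ≈ v i) → Σ< n u ≈ Σ< n v
  Σ<-cong zero    eq = refl
  Σ<-cong (suc n) eq = +-cong (Σ<-cong n (λ i i<n → eq i (ℕₚ.m<n⇒m<1+n i<n))) (eq n (ℕₚ.n<1+n n))

  Σ<-+ : ∀ n u v → Σ< n (λ i → u i + v i) ≈ Σ< n u + Σ< n v
  Σ<-+ zero    u v = solve 0 (con 0ℤ := con 0ℤ :+ con 0ℤ) refl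
  Σ<-+ (suc n) u v = trans (+-congʳ (Σ<-+ n u v))
    (solve 4 (λ a b c d → (a :+ b) :+ (c :+ d) := (a :+ c) :+ (b :+ d)) refl (Σ< n u) (Σ< n v) (u n) (v n))

  Σ<-* : ∀ n a u → Σ< n (λ i → a * u i) ≈ a * Σ< n u
  Σ<-* zero    a u = solve 1 (λ a → con 0ℤ := a :* con 0ℤ) refl a
  Σ<-* (suc n) a u = trans (+-congʳ (Σ<-* n a u)) (sym (distribˡ a _ _))

  Σ<-zero : ∀ n {u} → (∀ i → i < n → u i ≈ 𝟘) → Σ< n u ≈ 𝟘
  Σ<-zero n eq = trans (Σ<-cong n (λ i i<n → trans (eq i i<n) (solve 0 (con 0ℤ := con 0ℤ :* con 0ℤ) refl)))
    (trans (Σ<-* n 𝟘 (λ _ → 𝟘)) (solve 1 (λ a → con 0ℤ :* a := con 0ℤ) refl _))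

  Σ<-suc : ∀ n u → Σ< (suc n) u ≈ u 0 + Σ< n (λ i → u (suc i))
  Σ<-suc zero    u = +-comm _ _
  Σ<-suc (suc n) u = trans (+-congʳ (Σ<-suc n u)) (+-assoc _ _ _)

  Σ<-swap : ∀ m n (F : ℕ → Seq) → Σ< m (λ i → Σ< n (F i)) ≈ Σ< n (λ j → Σ< m (λ i → F i j))
  Σ<-swap zero    n F = sym (Σ<-zero n (λ _ _ → refl))
  Σ<-swap (suc m) n F = trans (+-congʳ (Σ<-swap m n F)) (sym (Σ<-+ n (λ j → Σ< m (λ i → F i j)) (F m)))

  -- The coefficient of t^r in (1 - t)^(-κ-1) is C(r + κ, κ).
  prefix-Σ : ∀ κ u s → prefix (suc κ) u s ≈ Σ< (suc s) (λ i → binom (s ∸ i ℕ.+ κ) κ * u i)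
  prefix-Σ zero    u zero    = solve 1 (λ a → a := con 0ℤ :+ con 1ℤ :* a) refl (u 0)
  prefix-Σ zero    u (suc s) = +-cong (prefix-Σ zero u s) (solve 1 (λ a → a := con 1ℤ :* a) refl (u (suc s)))
  prefix-Σ (suc κ) u zero    = trans (prefix-Σ κ u zero)
    (+-congˡ (*-congʳ (trans (binom-diag κ) (sym (binom-diag (suc κ))))))
  prefix-Σ (suc κ) u (suc s) = begin
    prefix (suc (suc κ)) u s + prefix (suc κ) u (suc s)
      ≈⟨ +-cong (prefix-Σ (suc κ) u s) (prefix-Σ κ u (suc s)) ⟩
    Σ< (suc s) v + (Σ< (suc s) w + w (suc s))
      ≈⟨ solve 3 (λ a b c → a :+ (b :+ c) := (b :+ a) :+ c) refl (Σ< (suc s) v) (Σ< (suc s) w) (w (suc s)) ⟩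
    (Σ< (suc s) w + Σ< (suc s) v) + w (suc s)
      ≈⟨ +-cong (Σ<-+ (suc s) w v) last ⟨
    Σ< (suc s) (λ i → w i + v i) + x (suc s)
      ≈⟨ +-congʳ (Σ<-cong (suc s) λ { i (s≤s i≤s) → split i i≤s }) ⟩
    Σ< (suc s) x + x (suc s) ∎
    where
    v w x : Seq
    v i = binom (s ∸ i ℕ.+ suc κ) (suc κ) * u i
    w i = binom (suc s ∸ i ℕ.+ κ) κ * u i
    x i = binom (suc s ∸ i ℕ.+ suc κ) (suc κ) * u i
    last : x (suc s) ≈ w (suc s)
    last rewrite ℕₚ.n∸n≡0 s = *-congʳ (trans (binom-diag (suc κ)) (sym (binom-diag κ)))
    split : ∀ i → i ≤ s → w i + v i ≈ x i
    split i i≤s rewrite ℕₚ.+-∸-assoc 1 i≤s | ℕₚ.+-suc (s ∸ i) κ = sym (distribʳ (u i) _ _)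

  -- Keeps the range of `prefix-Σ` at the price of a zero coefficient at i = s; the second product
  -- of `B` vanishes at the same place.
  shift-prefix-Σ : ∀ κ u s →
    shift (prefix (suc κ) u) s ≈ Σ< (suc s) (λ i → shift (λ t → binom (t ℕ.+ κ) κ) (s ∸ i) * u i)
  shift-prefix-Σ κ u zero    = solve 1 (λ a → con 0ℤ := con 0ℤ :+ con 0ℤ :* a) refl (u 0)
  shift-prefix-Σ κ u (suc s) = begin
    prefix (suc κ) u s
      ≈⟨ prefix-Σ κ u s ⟩
    Σ< (suc s) (λ i → binom (s ∸ i ℕ.+ κ) κ * u i)
      ≈⟨ Σ<-cong (suc s) (λ { i (s≤s i≤s) → *-congʳ (reflexive (≡.cong (shift b) (≡.sym (ℕₚ.+-∸-assoc 1 i≤s)))) }) ⟩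
    Σ< (suc s) w
      ≈⟨ solve 2 (λ a b → a := a :+ con 0ℤ :* b) refl (Σ< (suc s) w) (u (suc s)) ⟩
    Σ< (suc s) w + 𝟘 * u (suc s)
      ≈⟨ +-congˡ (*-congʳ (reflexive (≡.cong (shift b) (≡.sym (ℕₚ.n∸n≡0 s))))) ⟩
    Σ< (suc (suc s)) w ∎
    where
    b w : Seq
    b t = binom (t ℕ.+ κ) κ
    w i = shift b (suc s ∸ i) * u i

  -- The coefficient of x^j in (1 - x q) ⋯ (1 - x q^i).
  ε : ℕ → Seq
  ε zero    j = δ₀ j
  ε (suc i) j = ε i j - pow q (suc i) * shift (ε i) j

  ε-> : ∀ {i j} → i < j → ε i j ≈ 𝟘
  ε-> {zero}  {suc j} _         = refl
  ε-> {suc i} {suc j} (s≤s i<j) = trans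
    (+-cong (ε-> (ℕₚ.m<n⇒m<1+n i<j)) (-‿cong (*-congˡ (ε-> i<j))))
    (solve 1 (λ a → con 0ℤ :- a :* con 0ℤ := con 0ℤ) refl (pow q (suc i)))

  -- The bound J may exceed i: the induction step needs two different bounds for the same i, and a
  -- range common to all i lets the double sum be swapped afterwards.
  E-ε : ∀ i J m κ → i ≤ J → E i m κ ≈ Σ< (suc J) (λ j → ε i j * binom (m ℕ.+ j) κ)
  E-ε zero J m κ _ = begin
    binom m κ
      ≈⟨ solve 1 (λ a → a := con 1ℤ :* a :+ con 0ℤ) refl (binom m κ) ⟩
    𝟙 * binom m κ + 𝟘
      ≈⟨ +-cong (*-congˡ (reflexive (≡.cong (λ n → binom n κ) (≡.sym (ℕₚ.+-identityʳ m)))))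
           (sym (Σ<-zero J (λ j _ → solve 1 (λ a → con 0ℤ :* a := con 0ℤ) refl (binom (m ℕ.+ suc j) κ)))) ⟩
    𝟙 * binom (m ℕ.+ 0) κ + Σ< J (λ j → 𝟘 * binom (m ℕ.+ suc j) κ)
      ≈⟨ Σ<-suc J (λ j → δ₀ j * binom (m ℕ.+ j) κ) ⟨
    Σ< (suc J) (λ j → δ₀ j * binom (m ℕ.+ j) κ) ∎
  E-ε (suc i) (suc J) m κ (s≤s i≤J) = begin
    E i m κ - Q * E i (suc m) κ
      ≈⟨ +-cong (E-ε i (suc J) m κ (ℕₚ.m≤n⇒m≤1+n i≤J)) (-‿cong (*-congˡ (E-ε i J (suc m) κ i≤J))) ⟩
    Σ< (suc (suc J)) u - Q * Σ< (suc J) v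
      ≈⟨ +-congˡ (-‿cong (*-congˡ shifted)) ⟩
    Σ< (suc (suc J)) u - Q * Σ< (suc (suc J)) w
      ≈⟨ solve 3 (λ a b c → a :- b :* c := a :+ (:- b) :* c) refl (Σ< (suc (suc J)) u) Q (Σ< (suc (suc J)) w) ⟩
    Σ< (suc (suc J)) u + - Q * Σ< (suc (suc J)) w
      ≈⟨ +-congˡ (Σ<-* (suc (suc J)) (- Q) w) ⟨
    Σ< (suc (suc J)) u + Σ< (suc (suc J)) (λ j → - Q * w j)
      ≈⟨ Σ<-+ (suc (suc J)) u (λ j → - Q * w j) ⟨
    Σ< (suc (suc J)) (λ j → u j + - Q * w j)
      ≈⟨ Σ<-cong (suc (suc J)) (λ j _ → solve 4 (λ e s b Q → e :* b :+ (:- Q) :* (s :* b) := (e :- Q :* s) :* b) refl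
           (ε i j) (shift (ε i) j) (binom (m ℕ.+ j) κ) Q) ⟩
    Σ< (suc (suc J)) (λ j → ε (suc i) j * binom (m ℕ.+ j) κ) ∎
    where
    Q = pow q (suc i)
    u v w : Seq
    u j = ε i j * binom (m ℕ.+ j) κ
    v j = ε i j * binom (suc m ℕ.+ j) κ
    w j = shift (ε i) j * binom (m ℕ.+ j) κ
    shifted : Σ< (suc J) v ≈ Σ< (suc (suc J)) w
    shifted = begin
      Σ< (suc J) v
        ≈⟨ Σ<-cong (suc J) (λ j _ → *-congˡ (reflexive (≡.cong (λ n → binom n κ) (≡.sym (ℕₚ.+-suc m j))))) ⟩
      Σ< (suc J) (λ j → w (suc j))
        ≈⟨ solve 2 (λ a b → a := con 0ℤ :* b :+ a) refl _ (binom (m ℕ.+ 0) κ) ⟩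
      w 0 + Σ< (suc J) (λ j → w (suc j))
        ≈⟨ Σ<-suc (suc J) w ⟨
      Σ< (suc (suc J)) w ∎

  closed-ε : ∀ κ s → closed κ 0 s ≈ Σ< (suc s) (λ j → Σ< (suc s) (λ i → ε i j *
    (binom (s ℕ.+ κ ℕ.+ j) κ * binom (s ∸ i ℕ.+ κ) κ
      - binom (suc (s ℕ.+ κ) ℕ.+ j) κ * shift (λ t → binom (t ℕ.+ κ) κ) (s ∸ i))))
  closed-ε κ s = begin
    conv m κ 0 s - shift (conv (suc m) κ 0) s
      ≈⟨ +-cong (prefix-Σ κ (term m κ 0) s) (-‿cong (shift-prefix-Σ κ (term (suc m) κ 0) s)) ⟩
    Σ< (suc s) u - Σ< (suc s) v
      ≈⟨ solve 2 (λ a b → a :- b := a :+ (:- con 1ℤ) :* b) refl (Σ< (suc s) u) (Σ< (suc s) v) ⟩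
    Σ< (suc s) u + - 𝟙 * Σ< (suc s) v
      ≈⟨ trans (Σ<-+ (suc s) u (λ i → - 𝟙 * v i)) (+-congˡ (Σ<-* (suc s) (- 𝟙) v)) ⟨
    Σ< (suc s) (λ i → u i + - 𝟙 * v i)
      ≈⟨ Σ<-cong (suc s) (λ { i (s≤s i≤s) → row i i≤s }) ⟩
    Σ< (suc s) (λ i → Σ< (suc s) (λ j → F j i))
      ≈⟨ Σ<-swap (suc s) (suc s) (λ i j → F j i) ⟩
    Σ< (suc s) (λ j → Σ< (suc s) (F j)) ∎
    where
    m = s ℕ.+ κ
    b b′ u v : Seq
    b  i = binom (s ∸ i ℕ.+ κ) κ
    b′ i = shift (λ t → binom (t ℕ.+ κ) κ) (s ∸ i)
    u i = b i * term m κ 0 i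
    v i = b′ i * term (suc m) κ 0 i
    F : ℕ → Seq
    F j i = ε i j * (binom (m ℕ.+ j) κ * b i - binom (suc m ℕ.+ j) κ * b′ i)
    row : ∀ i → i ≤ s → u i + - 𝟙 * v i ≈ Σ< (suc s) (λ j → F j i)
    row i i≤s = begin
      b i * (E i m κ * 𝟙) + - 𝟙 * (b′ i * (E i (suc m) κ * 𝟙))
        ≈⟨ solve 4 (λ b b′ e e′ → b :* (e :* con 1ℤ) :+ (:- con 1ℤ) :* (b′ :* (e′ :* con 1ℤ)) := b :* e :+ (:- b′) :* e′) refl
             (b i) (b′ i) (E i m κ) (E i (suc m) κ) ⟩
      b i * E i m κ + - b′ i * E i (suc m) κ
        ≈⟨ +-cong (*-congˡ (E-ε i s m κ i≤s)) (*-congˡ (E-ε i s (suc m) κ i≤s)) ⟩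
      b i * Σ< (suc s) x + - b′ i * Σ< (suc s) y
        ≈⟨ trans (Σ<-+ (suc s) (λ j → b i * x j) (λ j → - b′ i * y j))
                 (+-cong (Σ<-* (suc s) (b i) x) (Σ<-* (suc s) (- b′ i) y)) ⟨
      Σ< (suc s) (λ j → b i * x j + - b′ i * y j)
        ≈⟨ Σ<-cong (suc s) (λ j _ → solve 5 (λ b b′ e c c′ → b :* (e :* c) :+ (:- b′) :* (e :* c′) := e :* (c :* b :- c′ :* b′)) refl
             (b i) (b′ i) (ε i j) (binom (m ℕ.+ j) κ) (binom (suc m ℕ.+ j) κ)) ⟩
      Σ< (suc s) (λ j → F j i) ∎
      where
      x y : Seq
      x j = ε i j * binom (m ℕ.+ j) κ
      y j = ε i j * binom (suc m ℕ.+ j) κ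

  -- From q-counts to weighted lattice paths

  qInt : ℕ → Carrier
  qInt zero    = 𝟘
  qInt (suc h) = 𝟙 + q * qInt h

  1-q*qInt : ∀ h → (𝟙 - q) * qInt h ≈ 1-q^ h
  1-q*qInt zero    = solve 1 (λ q → (con 1ℤ :- q) :* con 0ℤ := con 1ℤ :- con 1ℤ) refl q
  1-q*qInt (suc h) = begin
    (𝟙 - q) * (𝟙 + q * qInt h)
      ≈⟨ solve 2 (λ q x → (con 1ℤ :- q) :* (con 1ℤ :+ q :* x) := con 1ℤ :- q :+ q :* ((con 1ℤ :- q) :* x)) refl q (qInt h) ⟩
    𝟙 - q + q * ((𝟙 - q) * qInt h)
      ≈⟨ +-congˡ (*-congˡ (1-q*qInt h)) ⟩
    𝟙 - q + q * (𝟙 - pow q h)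
      ≈⟨ solve 2 (λ q x → con 1ℤ :- q :+ q :* (con 1ℤ :- x) := con 1ℤ :- q :* x) refl q (pow q h) ⟩
    1-q^ (suc h) ∎

  module _ (k : ℕ) where

    target : ℕ → ℕ → Carrier
    target zero    r = if r ℕ.≡ᵇ k then 𝟙 else 𝟘
    target (suc _) r = 𝟘

    -- steps u h r is the q-count of the completions of a word with r records, u unused values above its
    -- maximum and h below, to a permutation with k records; jumps counts those that begin with a record.
    mutual
      steps : ℕ → ℕ → ℕ → Carrier
      steps u zero    r = target u r + jumps u zero r
      steps u (suc h) r = qInt (suc h) * steps u h r + jumps u (suc h) r

      jumps : ℕ → ℕ → ℕ → Carrier
      jumps zero    h r = 𝟘
      jumps (suc u) h r = steps u h (suc r) + jumps u (suc h) r

    private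
      target-≢ : ∀ u {r} → r ≡.≢ k → target u r ≈ 𝟘
      target-≢ (suc u) r≢k = refl
      target-≢ zero {r} r≢k with r ℕ.≡ᵇ k in eq
      ... | false = refl
      ... | true  = contradiction (ℕₚ.≡ᵇ⇒≡ r k (≡.subst Data.Bool.T (≡.sym eq) _)) r≢k

      0+0 : ∀ {x y} → x ≈ 𝟘 → y ≈ 𝟘 → x + y ≈ 𝟘
      0+0 p q = trans (+-cong p q) (solve 0 (con 0ℤ :+ con 0ℤ := con 0ℤ) refl)

      *0 : ∀ a {y} → y ≈ 𝟘 → a * y ≈ 𝟘
      *0 a p = trans (*-congˡ p) (solve 1 (λ a → a :* con 0ℤ := con 0ℤ) refl a)

    mutual
      steps-many : ∀ u h {r} → k < r → steps u h r ≈ 𝟘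
      steps-many u zero    k<r = 0+0 (target-≢ u (≡.≢-sym (ℕₚ.<⇒≢ k<r))) (jumps-many u zero (ℕₚ.<⇒≤ k<r))
      steps-many u (suc h) k<r = 0+0 (*0 _ (steps-many u h k<r)) (jumps-many u (suc h) (ℕₚ.<⇒≤ k<r))

      jumps-many : ∀ u h {r} → k ≤ r → jumps u h r ≈ 𝟘
      jumps-many zero    h k≤r = refl
      jumps-many (suc u) h k≤r = 0+0 (steps-many u h (s≤s k≤r)) (jumps-many u (suc h) k≤r)

    mutual
      steps-few : ∀ u h {r k′} → r ℕ.+ k′ ≡ k → u < k′ → steps u h r ≈ 𝟘
      steps-few u (suc h) e u<k′ = 0+0 (*0 _ (steps-few u h e u<k′)) (jumps-few u (suc h) e u<k′)
      steps-few u zero {r} {suc k′} e u<k′ = 0+0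
        (target-≢ u (λ r≡k → ℕₚ.m≢1+m+n r (≡.trans (≡.trans r≡k (≡.sym e)) (ℕₚ.+-suc r k′))))
        (jumps-few u zero e u<k′)

      jumps-few : ∀ u h {r k′} → r ℕ.+ k′ ≡ k → u < k′ → jumps u h r ≈ 𝟘
      jumps-few zero    h e u<k′ = refl
      jumps-few (suc u) h {r} {suc k′} e (s≤s u<k′) = 0+0
        (steps-few u h (≡.trans (≡.sym (ℕₚ.+-suc r k′)) e) u<k′)
        (jumps-few u (suc h) e (ℕₚ.m<n⇒m<1+n u<k′))

    private
      p = 𝟙 - q

      walk-suc : ∀ h s → walk 0 (suc h) s ≈ 1-q^ (suc h) * walk 0 h s
      walk-suc h zero    = *-comm _ _
      walk-suc h (suc s) = solve 1 (λ a → con 0ℤ := a :* con 0ℤ) refl (1-q^ (suc h))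

      fall : ∀ h s {x w} → pow p (h ℕ.+ s) * x ≈ w →
        pow p (suc h ℕ.+ s) * (qInt (suc h) * x) ≈ 1-q^ (suc h) * w
      fall h s {x} {w} eq = begin
        p * pow p (h ℕ.+ s) * (qInt (suc h) * x)
          ≈⟨ solve 4 (λ p P b x → p :* P :* (b :* x) := (p :* b) :* (P :* x)) refl p (pow p (h ℕ.+ s)) (qInt (suc h)) x ⟩
        (p * qInt (suc h)) * (pow p (h ℕ.+ s) * x)
          ≈⟨ *-cong (1-q*qInt (suc h)) eq ⟩
        1-q^ (suc h) * w ∎

    mutual
      -- Of the k′ + s + h letters to come, h + s are not records, and each uses up one factor 1 - q
      -- in `fall`. Skipping a value raises h and lowers s, so a jump leaves the exponent alone.
      steps-walk : ∀ k′ s h {r} → r ℕ.+ k′ ≡ k → pow p (h ℕ.+ s) * steps (k′ ℕ.+ s) h r ≈ walk k′ h s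
      steps-walk zero zero zero {r} e
        rewrite ≡.sym e | ℕₚ.+-identityʳ r | ≡ᵇ-refl r = solve 0 (con 1ℤ :* (con 1ℤ :+ con 0ℤ) := con 1ℤ) refl
      steps-walk zero (suc s) zero {r} e = *0 _ (0+0 refl
        (jumps-many (suc s) zero (ℕₚ.≤-reflexive (≡.trans (≡.sym e) (ℕₚ.+-identityʳ r)))))
      steps-walk zero s (suc h) {r} e = begin
        pow p (suc h ℕ.+ s) * (qInt (suc h) * steps s h r + jumps s (suc h) r)
          ≈⟨ *-congˡ (+-congˡ (jumps-many s (suc h) (ℕₚ.≤-reflexive (≡.trans (≡.sym e) (ℕₚ.+-identityʳ r))))) ⟩
        pow p (suc h ℕ.+ s) * (qInt (suc h) * steps s h r + 𝟘)
          ≈⟨ solve 2 (λ a b → a :* (b :+ con 0ℤ) := a :* b) refl _ _ ⟩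
        pow p (suc h ℕ.+ s) * (qInt (suc h) * steps s h r)
          ≈⟨ fall h s (steps-walk zero s h e) ⟩
        1-q^ (suc h) * walk 0 h s
          ≈⟨ walk-suc h s ⟨
        walk 0 (suc h) s ∎
      steps-walk (suc k′) s zero {r} e = trans
        (*-congˡ (solve 1 (λ a → con 0ℤ :+ a := a) refl _)) (jumps-rise k′ s zero e)
      steps-walk (suc k′) s (suc h) {r} e = trans (distribˡ _ _ _)
        (+-cong (fall h s (steps-walk (suc k′) s h e)) (jumps-rise k′ s (suc h) e))

      jumps-rise : ∀ k′ s h {r} → r ℕ.+ suc k′ ≡ k → pow p (h ℕ.+ s) * jumps (suc (k′ ℕ.+ s)) h r ≈ rise k′ h s
      jumps-rise k′ zero h {r} e = begin
        -- With s = 0 every value above the maximum must become a record, so skipping one leaves too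
        -- few.
        pow p (h ℕ.+ 0) * (steps (k′ ℕ.+ 0) h (suc r) + jumps (k′ ℕ.+ 0) (suc h) r)
          ≈⟨ *-congˡ (+-congˡ (jumps-few (k′ ℕ.+ 0) (suc h) e (s≤s (ℕₚ.≤-reflexive (ℕₚ.+-identityʳ k′))))) ⟩
        pow p (h ℕ.+ 0) * (steps (k′ ℕ.+ 0) h (suc r) + 𝟘)
          ≈⟨ solve 2 (λ a b → a :* (b :+ con 0ℤ) := a :* b) refl _ _ ⟩
        pow p (h ℕ.+ 0) * steps (k′ ℕ.+ 0) h (suc r)
          ≈⟨ steps-walk k′ zero h (≡.trans (≡.sym (ℕₚ.+-suc r k′)) e) ⟩
        walk k′ h zero ∎
      jumps-rise k′ (suc s) h {r} e = trans (distribˡ _ _ _)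
        (+-cong (steps-walk k′ (suc s) h (≡.trans (≡.sym (ℕₚ.+-suc r k′)) e)) (begin
          pow p (h ℕ.+ suc s) * jumps (k′ ℕ.+ suc s) (suc h) r
            ≈⟨ reflexive (≡.cong₂ (λ a b → pow p a * jumps b (suc h) r) (ℕₚ.+-suc h s) (ℕₚ.+-suc k′ s)) ⟩
          pow p (suc h ℕ.+ s) * jumps (suc (k′ ℕ.+ s)) (suc h) r
            ≈⟨ jumps-rise k′ s (suc h) e ⟩
          rise k′ (suc h) s ∎))

  -- Gaussian coefficients and the q-binomial theorem

  sgn : ℕ → Carrier
  sgn zero    = 𝟙
  sgn (suc j) = - sgn j

  triangle : ℕ → ℕ
  triangle zero    = 0
  triangle (suc a) = suc a ℕ.+ triangle a

  -- The q-binomial coefficient of a + b over a, given by a q-Pascal rule; indexing by the two parts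
  -- avoids subtraction and division.
  gauss : ℕ → ℕ → Carrier
  gauss zero    b       = 𝟙
  gauss (suc a) zero    = 𝟙
  gauss (suc a) (suc b) = gauss (suc a) b + pow q (suc b) * gauss a (suc b)

  qFact : ℕ → Carrier
  qFact zero    = 𝟙
  qFact (suc n) = qFact n * qInt (suc n)

  qInt-+ : ∀ m n → qInt (m ℕ.+ n) ≈ qInt m + pow q m * qInt n
  qInt-+ zero    n = solve 1 (λ a → a := con 0ℤ :+ con 1ℤ :* a) refl (qInt n)
  qInt-+ (suc m) n = trans (+-congˡ (*-congˡ (qInt-+ m n)))
    (solve 4 (λ q a b c → con 1ℤ :+ q :* (a :+ b :* c) := (con 1ℤ :+ q :* a) :+ (q :* b) :* c) refl
      q (qInt m) (pow q m) (qInt n))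

  -- The q-Pascal rule matches the splitting [a+b+2] = [b+1] + q^(b+1) [a+1] of the last factor of
  -- the q-factorial.
  qFact-gauss : ∀ a b → qFact (a ℕ.+ b) ≈ gauss a b * (qFact a * qFact b)
  qFact-gauss zero    b    = solve 1 (λ x → x := con 1ℤ :* (con 1ℤ :* x)) refl (qFact b)
  qFact-gauss (suc a) zero = trans (reflexive (≡.cong qFact (ℕₚ.+-identityʳ (suc a))))
    (solve 1 (λ x → x := con 1ℤ :* (x :* con 1ℤ)) refl (qFact (suc a)))
  qFact-gauss (suc a) (suc b) = begin
    qFact (a ℕ.+ suc b) * qInt (suc a ℕ.+ suc b)
      ≈⟨ *-congˡ (trans (reflexive (≡.cong qInt (ℕₚ.+-comm (suc a) (suc b)))) (qInt-+ (suc b) (suc a))) ⟩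
    qFact (a ℕ.+ suc b) * (qInt (suc b) + Q * qInt (suc a))
      ≈⟨ solve 4 (λ X s t Q → X :* (s :+ Q :* t) := X :* s :+ Q :* (X :* t)) refl
           (qFact (a ℕ.+ suc b)) (qInt (suc b)) (qInt (suc a)) Q ⟩
    qFact (a ℕ.+ suc b) * qInt (suc b) + Q * (qFact (a ℕ.+ suc b) * qInt (suc a))
      ≈⟨ +-cong (*-congʳ (trans (reflexive (≡.cong qFact (ℕₚ.+-suc a b))) (qFact-gauss (suc a) b)))
                (*-congˡ (*-congʳ (qFact-gauss a (suc b)))) ⟩
    gauss (suc a) b * (qFact (suc a) * qFact b) * qInt (suc b)
      + Q * (gauss a (suc b) * (qFact a * qFact (suc b)) * qInt (suc a))
      ≈⟨ solve 7 (λ g g′ fa fb s t Q →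
           g :* ((fa :* t) :* fb) :* s :+ Q :* (g′ :* (fa :* (fb :* s)) :* t)
           := (g :+ Q :* g′) :* ((fa :* t) :* (fb :* s))) refl
           (gauss (suc a) b) (gauss a (suc b)) (qFact a) (qFact b) (qInt (suc b)) (qInt (suc a)) Q ⟩
    gauss (suc a) (suc b) * (qFact (suc a) * qFact (suc b)) ∎
    where Q = pow q (suc b)

  -- The q-binomial theorem. Multiplying by the last factor, 1 - x q^(a+b+2) in the main case,
  -- reproduces the q-Pascal rule, since q^(a+b+2) = q^(a+1) q^(b+1) and q^(a+1) completes the
  -- triangular power.
  ε-gauss : ∀ a b → ε (a ℕ.+ b) a ≈ sgn a * (pow q (triangle a) * gauss a b)
  ε-gauss zero zero    = solve 0 (con 1ℤ := con 1ℤ :* (con 1ℤ :* con 1ℤ)) refl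
  ε-gauss zero (suc b) = trans (+-congʳ (ε-gauss zero b))
    (solve 1 (λ Q → con 1ℤ :* (con 1ℤ :* con 1ℤ) :- Q :* con 0ℤ := con 1ℤ :* (con 1ℤ :* con 1ℤ)) refl (pow q (suc b)))
  ε-gauss (suc a) zero = begin
    ε (a ℕ.+ 0) (suc a) - pow q (suc (a ℕ.+ 0)) * ε (a ℕ.+ 0) a
      ≈⟨ +-cong (ε-> (s≤s (ℕₚ.≤-reflexive (ℕₚ.+-identityʳ a))))
           (-‿cong (*-cong (reflexive (≡.cong (λ n → pow q (suc n)) (ℕₚ.+-identityʳ a)))
             (trans (ε-gauss a zero) (*-congˡ (*-congˡ (gauss-0 a)))))) ⟩
    𝟘 - pow q (suc a) * (sgn a * (pow q (triangle a) * 𝟙))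
      ≈⟨ solve 3 (λ s Q T → con 0ℤ :- Q :* (s :* (T :* con 1ℤ)) := (:- s) :* ((Q :* T) :* con 1ℤ)) refl
           (sgn a) (pow q (suc a)) (pow q (triangle a)) ⟩
    - sgn a * (pow q (suc a) * pow q (triangle a) * 𝟙)
      ≈⟨ *-congˡ (*-congʳ (pow-+ q (suc a) (triangle a))) ⟨
    sgn (suc a) * (pow q (triangle (suc a)) * 𝟙) ∎
    where
    gauss-0 : ∀ a → gauss a 0 ≈ 𝟙
    gauss-0 zero    = refl
    gauss-0 (suc a) = refl
  ε-gauss (suc a) (suc b) = begin
    ε (a ℕ.+ suc b) (suc a) - pow q (suc a ℕ.+ suc b) * ε (a ℕ.+ suc b) a
      ≈⟨ +-cong (trans (reflexive (≡.cong (λ n → ε n (suc a)) (ℕₚ.+-suc a b)))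
                       (trans (ε-gauss (suc a) b) (*-congˡ (*-congʳ (pow-+ q (suc a) (triangle a))))))
           (-‿cong (*-cong (pow-+ q (suc a) (suc b)) (ε-gauss a (suc b)))) ⟩
    - sgn a * (A * U * gauss (suc a) b) - A * Q * (sgn a * (U * gauss a (suc b)))
      ≈⟨ solve 6 (λ s A U Q g g′ → (:- s) :* (A :* U :* g) :- A :* Q :* (s :* (U :* g′))
             := (:- s) :* (A :* U :* (g :+ Q :* g′))) refl
           (sgn a) A U Q (gauss (suc a) b) (gauss a (suc b)) ⟩
    - sgn a * (A * U * gauss (suc a) (suc b))
      ≈⟨ *-congˡ (*-congʳ (pow-+ q (suc a) (triangle a))) ⟨
    sgn (suc a) * (pow q (triangle (suc a)) * gauss (suc a) (suc b)) ∎
    where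
    A = pow q (suc a)
    U = pow q (triangle a)
    Q = pow q (suc b)

  -- Summation over permutations

  Σ<-split : ∀ m n u → Σ< (m ℕ.+ n) u ≈ Σ< m u + Σ< n (λ i → u (m ℕ.+ i))
  Σ<-split m zero    u rewrite ℕₚ.+-identityʳ m = solve 1 (λ a → a := a :+ con 0ℤ) refl (Σ< m u)
  Σ<-split m (suc n) u rewrite ℕₚ.+-suc m n = trans (+-congʳ (Σ<-split m n u)) (+-assoc _ _ _)

  if-cong : ∀ b {x y} → x ≈ y → (if b then x else 𝟘) ≈ (if b then y else 𝟘)
  if-cong true  eq = eq
  if-cong false eq = refl

  -- The admissible values below t have 0, 1, 2, ... admissible values above them. A new largest one
  -- contributes 1 and raises all earlier exponents by one.
  qInt-count : ∀ P t →
    Σ< t (λ x → if P x then pow q (count (λ v → (x <ᵇ v) ∧ P v) t) else 𝟘) ≈ qInt (count P t)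
  qInt-count P zero    = refl
  qInt-count P (suc t) = trans (+-congˡ last) (by-last (P t) ≡.refl)
    where
    last : (if P t then pow q (count (λ v → (t <ᵇ v) ∧ P v) (suc t)) else 𝟘) ≈ (if P t then 𝟙 else 𝟘)
    last = if-cong (P t) (reflexive (≡.cong (pow q) (count-none _ (suc t) λ
      { v (s≤s v≤t) → ≡.cong (_∧ P v) (≥⇒<ᵇ≡false v≤t) })))

    by-last : ∀ b → P t ≡ b →
      Σ< t (λ x → if P x then pow q (count (λ v → (x <ᵇ v) ∧ P v) (suc t)) else 𝟘) + (if b then 𝟙 else 𝟘)
      ≈ qInt (𝟏? b ℕ.+ count P t)
    by-last false Pt = begin
      Σ< t (λ x → if P x then pow q (count (λ v → (x <ᵇ v) ∧ P v) (suc t)) else 𝟘) + 𝟘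
        ≈⟨ +-congʳ (Σ<-cong t (λ x _ → reflexive (≡.cong
             (λ b → if P x then pow q (𝟏? b ℕ.+ count (λ v → (x <ᵇ v) ∧ P v) t) else 𝟘)
             (≡.trans (≡.cong ((x <ᵇ t) ∧_) Pt) (𝔹ₚ.∧-zeroʳ (x <ᵇ t)))))) ⟩
      Σ< t (λ x → if P x then pow q (count (λ v → (x <ᵇ v) ∧ P v) t) else 𝟘) + 𝟘
        ≈⟨ solve 1 (λ a → a :+ con 0ℤ := a) refl _ ⟩
      Σ< t (λ x → if P x then pow q (count (λ v → (x <ᵇ v) ∧ P v) t) else 𝟘)
        ≈⟨ qInt-count P t ⟩
      qInt (count P t) ∎
    by-last true Pt = begin
      Σ< t (λ x → if P x then pow q (count (λ v → (x <ᵇ v) ∧ P v) (suc t)) else 𝟘) + 𝟙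
        ≈⟨ +-congʳ (Σ<-cong t (λ x x<t → trans (reflexive (≡.cong
             (λ b → if P x then pow q (𝟏? b ℕ.+ count (λ v → (x <ᵇ v) ∧ P v) t) else 𝟘)
             (≡.cong₂ _∧_ (<⇒<ᵇ≡true x<t) Pt))) (pull x))) ⟩
      Σ< t (λ x → q * (if P x then pow q (count (λ v → (x <ᵇ v) ∧ P v) t) else 𝟘)) + 𝟙
        ≈⟨ trans (+-congʳ (trans (Σ<-* t q _) (*-congˡ (qInt-count P t)))) (+-comm _ _) ⟩
      𝟙 + q * qInt (count P t) ∎
      where
      pull : ∀ x → (if P x then q * pow q (count (λ v → (x <ᵇ v) ∧ P v) t) else 𝟘)
                 ≈ q * (if P x then pow q (count (λ v → (x <ᵇ v) ∧ P v) t) else 𝟘)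
      pull x with P x
      ... | true  = refl
      ... | false = solve 1 (λ q → con 0ℤ := q :* con 0ℤ) refl q

  -- Here a is the number of values skipped between the old maximum and the new one.
  jumps-Σ : ∀ k u h r → jumps k u h r ≈ Σ< u (λ a → steps k (u ∸ suc a) (h ℕ.+ a) (suc r))
  jumps-Σ k zero    h r = refl
  jumps-Σ k (suc u) h r = sym (trans
    (Σ<-suc u (λ a → steps k (u ∸ a) (h ℕ.+ a) (suc r)))
    (+-cong (reflexive (≡.cong (λ x → steps k u x (suc r)) (ℕₚ.+-identityʳ h)))
      (trans (Σ<-cong u (λ a _ → reflexive (≡.cong (λ x → steps k (u ∸ suc a) x (suc r)) (ℕₚ.+-suc h a))))
             (sym (jumps-Σ k u (suc h) r)))))

  module _ (n k : ℕ) where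

    extend : ℕ → (List ℕ → Carrier) → List ℕ → Carrier
    extend zero    F ys = F ys
    extend (suc m) F ys = Σ< n (λ x → extend m F (x ∷ ys))

    weight : List ℕ → Carrier
    weight ys = if distinct ys ∧ (records ys ≡ᵇ k) then pow q (inversions ys) else 𝟘

    extend-repeated : ∀ m ys → distinct ys ≡ false → extend m weight ys ≈ 𝟘
    extend-repeated zero    ys e rewrite e = refl
    extend-repeated (suc m) ys e = Σ<-zero n (λ x _ → extend-repeated m (x ∷ ys)
      (≡.trans (≡.cong (free ys x ∧_) e) (𝔹ₚ.∧-zeroʳ (free ys x))))

    extend-weight : ∀ m ys u → distinct ys ≡ true → top ys ℕ.+ u ≡ n → below ys ℕ.+ u ≡ m →
      extend m weight ys ≈ pow q (potential ys) * steps k u (below ys) (records ys)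

    extend-record : ∀ m ys u → distinct ys ≡ true → top ys ℕ.+ u ≡ n → below ys ℕ.+ u ≡ suc m → ∀ a → a < u →
      extend m weight ((top ys ℕ.+ a) ∷ ys)
      ≈ pow q (potential ys) * steps k (u ∸ suc a) (below ys ℕ.+ a) (suc (records ys))
    extend-record m ys u dist topu belowu a a<u = begin
      extend m weight (x ∷ ys)
        ≈⟨ extend-weight m (x ∷ ys) u′ (≡.cong₂ _∧_ fx dist) top′ below′ ⟩
      pow q (potential (x ∷ ys)) * steps k u′ (below (x ∷ ys)) (records (x ∷ ys))
        ≈⟨ *-cong (reflexive (≡.cong (pow q) pot′)) (reflexive (≡.cong₂ (steps k u′) (below-∷-record ys a) rec′)) ⟩
      pow q (potential ys) * steps k u′ (below ys ℕ.+ a) (suc (records ys)) ∎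
      where
      t = top ys
      x = t ℕ.+ a
      u′ = u ∸ suc a
      u≡ : suc a ℕ.+ u′ ≡ u
      u≡ = ℕₚ.m+[n∸m]≡n a<u
      fx : free ys x ≡ true
      fx = top≤⇒free ys x (ℕₚ.m≤m+n t a)
      top′ : top (x ∷ ys) ℕ.+ u′ ≡ n
      top′ = ≡.trans (≡.cong (ℕ._+ u′) (ℕₚ.m≥n⇒m⊔n≡m (ℕₚ.m≤n⇒m≤1+n (ℕₚ.m≤m+n t a))))
        (≡.trans (≡.cong (ℕ._+ u′) (≡.sym (ℕₚ.+-suc t a)))
          (≡.trans (ℕₚ.+-assoc t (suc a) u′) (≡.trans (≡.cong (t ℕ.+_) u≡) topu)))
      below′ : below (x ∷ ys) ℕ.+ u′ ≡ m
      below′ = ≡.trans (≡.cong (ℕ._+ u′) (below-∷-record ys a))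
        (ℕₚ.suc-injective (≡.trans (≡.cong (ℕ._+ u′) (≡.sym (ℕₚ.+-suc (below ys) a)))
          (≡.trans (ℕₚ.+-assoc (below ys) (suc a) u′) (≡.trans (≡.cong (below ys ℕ.+_) u≡) belowu))))
      pot′ : potential (x ∷ ys) ≡ potential ys
      pot′ = ≡.trans (potential-∷ x ys fx) (≡.cong (ℕ._+ potential ys)
        (count-none _ t (λ v v<t → ≡.cong (_∧ free ys v) (≥⇒<ᵇ≡false (ℕₚ.≤-trans (ℕₚ.<⇒≤ v<t) (ℕₚ.m≤m+n t a))))))
      rec′ : records (x ∷ ys) ≡ suc (records ys)
      rec′ = ≡.cong (λ b → 𝟏? b ℕ.+ records ys) (≤⇒≤ᵇ≡true (ℕₚ.m≤m+n t a))

    extend-low : ∀ m ys u → distinct ys ≡ true → top ys ℕ.+ u ≡ n → ∀ h → below ys ≡ suc h → h ℕ.+ u ≡ m →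
      ∀ x → x < top ys →
      extend m weight (x ∷ ys)
      ≈ pow q (potential ys) * steps k u h (records ys) * (if free ys x then pow q (gap ys x (top ys)) else 𝟘)
    extend-low m ys u dist topu h below≡ hu x x<t with free ys x in fx
    ... | false = trans (extend-repeated m (x ∷ ys) (≡.cong (_∧ distinct ys) fx))
                        (solve 1 (λ a → con 0ℤ := a :* con 0ℤ) refl _)
    ... | true  = begin
      extend m weight (x ∷ ys)
        ≈⟨ extend-weight m (x ∷ ys) u (≡.cong₂ _∧_ fx dist)
             (≡.trans (≡.cong (ℕ._+ u) (ℕₚ.m≤n⇒m⊔n≡n x<t)) topu)
             (≡.trans (≡.cong (ℕ._+ u) below′) hu) ⟩
      pow q (potential (x ∷ ys)) * steps k u (below (x ∷ ys)) (records (x ∷ ys))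
        ≈⟨ *-cong (trans (reflexive (≡.cong (pow q) (potential-∷ x ys fx))) (pow-+ q (gap ys x (top ys)) (potential ys)))
                  (reflexive (≡.cong₂ (steps k u) below′ (≡.cong (λ b → 𝟏? b ℕ.+ records ys) (>⇒≤ᵇ≡false x<t)))) ⟩
      pow q (gap ys x (top ys)) * pow q (potential ys) * steps k u h (records ys)
        ≈⟨ solve 3 (λ a b c → a :* b :* c := b :* c :* a) refl _ _ _ ⟩
      pow q (potential ys) * steps k u h (records ys) * pow q (gap ys x (top ys)) ∎
      where
      below′ : below (x ∷ ys) ≡ h
      below′ = ℕₚ.suc-injective (≡.trans (below-∷-free x ys fx x<t) below≡)

    extend-weight zero ys u dist topu belowu
      -- The word is complete: nothing is pending, and the potential is the number of special
      -- inversions.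
      rewrite ℕₚ.m+n≡0⇒m≡0 (below ys) belowu | ℕₚ.m+n≡0⇒n≡0 (below ys) belowu | dist
            | pending-done ys ys (ℕₚ.m+n≡0⇒m≡0 (below ys) belowu) ℕₚ.≤-refl | ℕₚ.+-identityʳ (inversions ys)
      with records ys ≡ᵇ k
    ... | true  = solve 1 (λ a → a := a :* (con 1ℤ :+ con 0ℤ)) refl _
    ... | false = solve 1 (λ a → con 0ℤ := a :* (con 0ℤ :+ con 0ℤ)) refl (pow q (inversions ys))
    extend-weight (suc m) ys u dist topu belowu = begin
      Σ< n F
        ≈⟨ reflexive (≡.cong (λ n → Σ< n F) (≡.sym topu)) ⟩
      Σ< (top ys ℕ.+ u) F
        ≈⟨ Σ<-split (top ys) u F ⟩
      Σ< (top ys) F + Σ< u (λ a → F (top ys ℕ.+ a))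
        ≈⟨ +-congˡ (begin
             Σ< u (λ a → F (top ys ℕ.+ a))
               ≈⟨ Σ<-cong u (extend-record m ys u dist topu belowu) ⟩
             Σ< u (λ a → W * steps k (u ∸ suc a) (below ys ℕ.+ a) (suc r))
               ≈⟨ Σ<-* u W _ ⟩
             W * Σ< u (λ a → steps k (u ∸ suc a) (below ys ℕ.+ a) (suc r))
               ≈⟨ *-congˡ (jumps-Σ k u (below ys) r) ⟨
             W * jumps k u (below ys) r ∎) ⟩
      Σ< (top ys) F + W * jumps k u (below ys) r
        ≈⟨ low (below ys) ≡.refl ⟩
      W * steps k u (below ys) r ∎
      where
      F : ℕ → Carrier
      F x = extend m weight (x ∷ ys)
      W = pow q (potential ys)
      r = records ys
      low : ∀ h → below ys ≡ h → Σ< (top ys) F + W * jumps k u h r ≈ W * steps k u h r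
      low zero below≡ = trans (+-congʳ (Σ<-zero (top ys) (λ x x<t →
          extend-repeated m (x ∷ ys) (≡.cong (_∧ distinct ys) (count≡0⇒none (free ys) (top ys) below≡ x x<t)))))
        (no-target u (≡.trans (≡.sym (≡.cong (ℕ._+ u) below≡)) belowu))
        where
        -- Letters are missing and none fits below the maximum, so u is positive and `target`
        -- computes to zero.
        no-target : ∀ u → u ≡ suc m → 𝟘 + W * jumps k u 0 r ≈ W * steps k u 0 r
        no-target (suc u) _ = solve 2 (λ c j → con 0ℤ :+ c :* j := c :* (con 0ℤ :+ j)) refl W (jumps k (suc u) 0 r)
      low (suc h) below≡ = begin
        Σ< (top ys) F + W * jumps k u (suc h) r
          ≈⟨ +-congʳ (Σ<-cong (top ys) (extend-low m ys u dist topu h below≡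
               (ℕₚ.suc-injective (≡.trans (≡.sym (≡.cong (ℕ._+ u) below≡)) belowu)))) ⟩
        Σ< (top ys) (λ x → W * steps k u h r * G x) + W * jumps k u (suc h) r
          ≈⟨ +-congʳ (trans (Σ<-* (top ys) (W * steps k u h r) G) (*-congˡ (trans (qInt-count (free ys) (top ys)) (reflexive (≡.cong qInt below≡))))) ⟩
        W * steps k u h r * qInt (suc h) + W * jumps k u (suc h) r
          ≈⟨ solve 4 (λ c s i j → c :* s :* i :+ c :* j := c :* (i :* s :+ j)) refl W (steps k u h r) (qInt (suc h)) (jumps k u (suc h) r) ⟩
        W * (qInt (suc h) * steps k u h r + jumps k u (suc h) r) ∎
        where
        G : ℕ → Carrier
        G x = if free ys x then pow q (gap ys x (top ys)) else 𝟘

  permutations-weight : ∀ n k → extend n k n (weight n k) [] ≈ steps k n 0 0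
  permutations-weight n k = trans (extend-weight n k n [] n ≡.refl ≡.refl ≡.refl)
    (solve 1 (λ a → con 1ℤ :* a := a) refl (steps k n 0 0))

  -- Ends in `0#` rather than `𝟘`, which makes it compute to `sumP` on coefficient lists.
  ∑ : List Carrier → Carrier
  ∑ = foldr _+_ 0#

  ∑-cong : ∀ {A : Set} {f g : A → Carrier} (L : List A) → (∀ x → f x ≈ g x) → ∑ (map f L) ≈ ∑ (map g L)
  ∑-cong []      eq = refl
  ∑-cong (x ∷ L) eq = +-cong (eq x) (∑-cong L eq)

  ∑-++ : ∀ {A : Set} (f : A → Carrier) L M → ∑ (map f (L ++ M)) ≈ ∑ (map f L) + ∑ (map f M)
  ∑-++ f []      M = sym (+-identityˡ _)
  ∑-++ f (x ∷ L) M = trans (+-congˡ (∑-++ f L M)) (sym (+-assoc _ _ _))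

  ∑-concatMap : ∀ {A B : Set} (f : B → Carrier) (h : A → List B) L →
    ∑ (map f (concatMap h L)) ≈ ∑ (map (λ x → ∑ (map f (h x))) L)
  ∑-concatMap f h []      = refl
  ∑-concatMap f h (x ∷ L) = trans (∑-++ f (h x) (concatMap h L)) (+-congˡ (∑-concatMap f h L))

  ∑-+ : ∀ {A : Set} (f g : A → Carrier) L → ∑ (map (λ x → f x + g x) L) ≈ ∑ (map f L) + ∑ (map g L)
  ∑-+ f g []      = sym (+-identityˡ 0#)
  ∑-+ f g (x ∷ L) = trans (+-congˡ (∑-+ f g L))
    (solve 4 (λ a b c d → (a :+ b) :+ (c :+ d) := (a :+ c) :+ (b :+ d)) refl
      (f x) (g x) (∑ (map f L)) (∑ (map g L)))

  ∑-zero : ∀ {A : Set} (L : List A) → ∑ (map (λ _ → 0#) L) ≈ 0#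
  ∑-zero []      = refl
  ∑-zero (x ∷ L) = trans (+-identityˡ _) (∑-zero L)

  ∑-swap : ∀ {A B : Set} (G : A → B → Carrier) L M →
    ∑ (map (λ x → ∑ (map (G x) M)) L) ≈ ∑ (map (λ y → ∑ (map (λ x → G x y) L)) M)
  ∑-swap G []      M = sym (∑-zero M)
  ∑-swap G (x ∷ L) M = trans (+-congˡ (∑-swap G L M)) (sym (∑-+ (G x) (λ y → ∑ (map (λ x → G x y) L)) M))

  ∑-tabulate : ∀ {A : Set} {n} (f : A → Carrier) (g : Fin n → A) F →
    (∀ i → f (g i) ≈ F (toℕ i)) → ∑ (map f (tabulate g)) ≈ Σ< n F
  ∑-tabulate {n = zero}  f g F eq = sym 0-homo
  ∑-tabulate {n = suc n} f g F eq = trans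
    (+-cong (eq Fin.zero) (∑-tabulate f (g ∘ Fin.suc) (F ∘ suc) (eq ∘ Fin.suc)))
    (sym (Σ<-suc n F))

  ∑-applyUpTo : ∀ {A : Set} (f : A → Carrier) (g : ℕ → A) n → ∑ (map f (applyUpTo g n)) ≈ Σ< n (f ∘ g)
  ∑-applyUpTo f g zero    = sym 0-homo
  ∑-applyUpTo f g (suc n) = trans (+-congˡ (∑-applyUpTo f (g ∘ suc) n)) (sym (Σ<-suc n (f ∘ g)))

  -- `words` chooses the leftmost letter first, `extend` the rightmost. This isolates the leftmost
  -- letter as the innermost sum.
  extend-suc : ∀ n k m F ys → extend n k (suc m) F ys ≈ extend n k m (λ zs → Σ< n (λ x → F (x ∷ zs))) ys
  extend-suc n k zero    F ys = refl
  extend-suc n k (suc m) F ys = Σ<-cong n (λ x _ → extend-suc n k m F (x ∷ ys))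

  ∑-words : ∀ n k m F → ∑ (map (λ w → F (map toℕ w)) (words n m)) ≈ extend n k m F []
  ∑-words n k zero    F = +-identityʳ _
  ∑-words n k (suc m) F = begin
    ∑ (map W (concatMap (λ x → map (x ∷_) (words n m)) (allFin n)))
      ≈⟨ ∑-concatMap W (λ x → map (x ∷_) (words n m)) (allFin n) ⟩
    ∑ (map (λ x → ∑ (map W (map (x ∷_) (words n m)))) (allFin n))
      ≈⟨ ∑-cong (allFin n) (λ x → reflexive (≡.cong ∑ (≡.sym (Listₚ.map-∘ (words n m))))) ⟩
    ∑ (map (λ x → ∑ (map (λ w → W (x ∷ w)) (words n m))) (allFin n))
      ≈⟨ ∑-swap (λ x w → W (x ∷ w)) (allFin n) (words n m) ⟩
    ∑ (map (λ w → ∑ (map (λ x → W (x ∷ w)) (allFin n))) (words n m))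
      ≈⟨ ∑-cong (words n m) (λ w → ∑-tabulate (λ x → W (x ∷ w)) id (λ x → F (x ∷ map toℕ w)) (λ _ → refl)) ⟩
    ∑ (map (λ w → Σ< n (λ x → F (x ∷ map toℕ w))) (words n m))
      ≈⟨ ∑-words n k m (λ zs → Σ< n (λ x → F (x ∷ zs))) ⟩
    extend n k m (λ zs → Σ< n (λ x → F (x ∷ zs))) []
      ≈⟨ extend-suc n k m F [] ⟨
    extend n k (suc m) F [] ∎
    where
    W : List (Fin n) → Carrier
    W w = F (map toℕ w)

  ∑-withRecords : ∀ n k (f : List (Fin n) → Carrier) → (∀ σ → f σ ≈ pow q (inv′ σ)) → ∀ L →
    ∑ (map f (withRecords n k (filter (UDec.unique? Finₚ._≟_) L))) ≈ ∑ (map (λ σ → weight n k (map toℕ σ)) L)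
  ∑-withRecords n k f eq []      = refl
  ∑-withRecords n k f eq (σ ∷ L) with does (UDec.unique? Finₚ._≟_ σ) in unique
  ... | false rewrite ≡.trans (≡.sym (unique?-distinct σ)) unique
    = trans (∑-withRecords n k f eq L) (trans (sym (+-identityˡ _)) (+-congʳ (sym 0-homo)))
  ... | true rewrite ≡.trans (≡.sym (unique?-distinct σ)) unique | ≡.sym (rlm-records σ) with rlm σ ≡ᵇ k
  ... | false = trans (∑-withRecords n k f eq L) (trans (sym (+-identityˡ _)) (+-congʳ (sym 0-homo)))
  ... | true  = +-cong
    (trans (eq σ) (reflexive (≡.cong (pow q) (inv′-inversions σ (≡.trans (≡.sym (unique?-distinct σ)) unique)))))
    (∑-withRecords n k f eq L)

  ∑-Sym : ∀ n k (f : List (Fin n) → Carrier) → (∀ σ → f σ ≈ pow q (inv′ σ)) →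
    ∑ (map f (withRecords n k (Sym n))) ≈ steps k n 0 0
  ∑-Sym n k f eq = trans (∑-withRecords n k f eq (words n n))
    (trans (∑-words n k n (weight n k)) (permutations-weight n k))

  -- Completes the triangle j ≤ i ≤ s to a square, on which sums can be interchanged.
  ∑-triangle : ∀ s (T F : ℕ → ℕ → Carrier) →
    (∀ j i → j ≤ i → i ≤ s → T j i ≈ F j i) → (∀ j i → i < j → F j i ≈ 𝟘) →
    ∑ (map (λ j → ∑ (map (T j) (map (j ℕ.+_) (upTo (suc s ∸ j))))) (upTo (suc s)))
    ≈ Σ< (suc s) (λ j → Σ< (suc s) (F j))
  ∑-triangle s T F T≈F lower = trans
    (∑-applyUpTo (λ j → ∑ (map (T j) (map (j ℕ.+_) (upTo (suc s ∸ j))))) id (suc s))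
    (Σ<-cong (suc s) λ { j (s≤s j≤s) → row j (ℕₚ.m≤n⇒m≤1+n j≤s) })
    where
    row : ∀ j → j ≤ suc s → ∑ (map (T j) (map (j ℕ.+_) (upTo (suc s ∸ j)))) ≈ Σ< (suc s) (F j)
    row j j≤ = begin
      ∑ (map (T j) (map (j ℕ.+_) (upTo m)))
        ≈⟨ reflexive (≡.cong ∑ (≡.sym (Listₚ.map-∘ (upTo m)))) ⟩
      ∑ (map (T j ∘ (j ℕ.+_)) (upTo m))
        ≈⟨ ∑-applyUpTo (T j ∘ (j ℕ.+_)) id m ⟩
      Σ< m (T j ∘ (j ℕ.+_))
        ≈⟨ Σ<-cong m (λ i i<m → T≈F j (j ℕ.+ i) (ℕₚ.m≤m+n j i)
             (ℕₚ.≤-pred (≡.subst (j ℕ.+ i <_) (ℕₚ.m+[n∸m]≡n j≤) (ℕₚ.+-monoʳ-< j i<m)))) ⟩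
      Σ< m (F j ∘ (j ℕ.+_))
        ≈⟨ solve 1 (λ a → a := con 0ℤ :+ a) refl _ ⟩
      𝟘 + Σ< m (F j ∘ (j ℕ.+_))
        ≈⟨ +-congʳ (Σ<-zero j (λ i i<j → lower j i i<j)) ⟨
      Σ< j (F j) + Σ< m (F j ∘ (j ℕ.+_))
        ≈⟨ Σ<-split j m (F j) ⟨
      Σ< (j ℕ.+ m) (F j)
        ≈⟨ reflexive (≡.cong (λ n → Σ< n (F j)) (ℕₚ.m+[n∸m]≡n j≤)) ⟩
      Σ< (suc s) (F j) ∎
      where m = suc s ∸ j

  -- Division of polynomials

  -- The value of a coefficient list whose head is the coefficient of highest degree.
  val : List ℤ → Carrier
  val []      = 𝟘
  val (c ∷ r) = ⟦ c ⟧ * pow q (length r) + val r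

  length-subtract : ∀ r b → length (subtract r b) ≡ length r
  length-subtract r       []      = ≡.refl
  length-subtract []      (y ∷ b) = ≡.refl
  length-subtract (x ∷ r) (y ∷ b) = ≡.cong suc (length-subtract r b)

  -- `subtract` aligns the two lists at their leading entries, so b is taken away times a power of
  -- q.
  val-subtract : ∀ r b → length b ≤ length r →
    val (subtract r b) + pow q (length r ∸ length b) * val b ≈ val r
  val-subtract r       []      _ = solve 2 (λ a p → a :+ p :* con 0ℤ := a) refl (val r) (pow q (length r))
  val-subtract (x ∷ r) (y ∷ b) (s≤s b≤r) = begin
    (⟦ x ℤ.- y ⟧ * pow q (length (subtract r b)) + val (subtract r b)) + P * (⟦ y ⟧ * Q + val b)
      ≈⟨ +-congʳ (+-congʳ (*-cong (trans (+-homo x (ℤ.- y)) (+-congˡ (-‿homo y)))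
           (trans (reflexive (≡.cong (pow q) (≡.trans (length-subtract r b) (≡.sym (ℕₚ.m∸n+n≡m b≤r)))))
                  (pow-+ q (length r ∸ length b) (length b))))) ⟩
    ((⟦ x ⟧ - ⟦ y ⟧) * (P * Q) + val (subtract r b)) + P * (⟦ y ⟧ * Q + val b)
      ≈⟨ solve 6 (λ x y P Q v w → ((x :- y) :* (P :* Q) :+ v) :+ P :* (y :* Q :+ w) := x :* (P :* Q) :+ (v :+ P :* w)) refl
           ⟦ x ⟧ ⟦ y ⟧ P Q (val (subtract r b)) (val b) ⟩
    ⟦ x ⟧ * (P * Q) + (val (subtract r b) + P * val b)
      ≈⟨ +-cong (*-congˡ (trans (sym (pow-+ q (length r ∸ length b) (length b)))
                                (reflexive (≡.cong (pow q) (ℕₚ.m∸n+n≡m b≤r)))))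
                (val-subtract r b b≤r) ⟩
    val (x ∷ r) ∎
    where
    P = pow q (length r ∸ length b)
    Q = pow q (length b)

  val-map-* : ∀ c b → val (map (c ℤ.*_) b) ≈ ⟦ c ⟧ * val b
  val-map-* c []      = solve 1 (λ c → con 0ℤ := c :* con 0ℤ) refl ⟦ c ⟧
  val-map-* c (y ∷ b) = trans
    (+-cong (*-cong (*-homo c y) (reflexive (≡.cong (pow q) (Listₚ.length-map (c ℤ.*_) b)))) (val-map-* c b))
    (solve 4 (λ c y P v → c :* y :* P :+ c :* v := c :* (y :* P :+ v)) refl ⟦ c ⟧ ⟦ y ⟧ (pow q (length b)) (val b))

  val-dropZeros : ∀ p l → val (dropZeros p l) ≈ val l
  val-dropZeros p []             = refl
  val-dropZeros p (+ zero ∷ l)   = trans (val-dropZeros p l)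
    (solve 2 (λ v P → v := con 0ℤ :* P :+ v) refl (val l) (pow q (length l)))
  val-dropZeros p (+ suc _ ∷ l)  = refl
  val-dropZeros p (-[1+ _ ] ∷ l) = refl

  -- In a list with the highest degree first, the degree of an entry is the length of what follows;
  -- this gives the degree of each new quotient coefficient in `division`.
  length-divLoop : ∀ f d bs r → length r ≤ f → length (divLoop f d bs r) ≡ length r ∸ d
  length-divLoop zero    d bs []      _ = ≡.sym (ℕₚ.0∸n≡0 d)
  length-divLoop (suc f) d bs []      _ = ≡.sym (ℕₚ.0∸n≡0 d)
  length-divLoop (suc f) d bs (c ∷ r) (s≤s r≤f) with d ≤ᵇ length r in d≤?r
  ... | false = ≡.sym (ℕₚ.m≤n⇒m∸n≡0 {suc (length r)} {d} (ℕₚ.≰⇒> λ d≤r → ≡.subst T d≤?r (ℕₚ.≤⇒≤ᵇ d≤r)))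
  ... | true  = ≡.trans
    (≡.cong suc (≡.trans (length-divLoop f d bs _ (≡.subst (_≤ f) (≡.sym (length-subtract r cbs)) r≤f))
      (≡.cong (_∸ d) (length-subtract r cbs))))
    (≡.sym (ℕₚ.+-∸-assoc 1 {length r} {d} (ℕₚ.≤ᵇ⇒≤ d (length r) (≡.subst T (≡.sym d≤?r) _))))
    where cbs = map (c ℤ.*_) bs

  division : ∀ f bs r → length r ≤ f → ∃ λ rem → length rem ≤ length bs ×
    val r ≈ val (divLoop f (length bs) bs r) * val (1ℤ ∷ bs) + val rem
  division zero    bs [] _ = [] , z≤n , solve 1 (λ D → con 0ℤ := con 0ℤ :* D :+ con 0ℤ) refl (val (1ℤ ∷ bs))
  division (suc f) bs [] _ = [] , z≤n , solve 1 (λ D → con 0ℤ := con 0ℤ :* D :+ con 0ℤ) refl (val (1ℤ ∷ bs))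
  division (suc f) bs (c ∷ r) (s≤s r≤f) with length bs ≤ᵇ length r in d≤?r
  ... | false = c ∷ r , ℕₚ.≰⇒> (λ d≤r → ≡.subst T d≤?r (ℕₚ.≤⇒≤ᵇ d≤r)) ,
                solve 2 (λ D v → v := con 0ℤ :* D :+ v) refl (val (1ℤ ∷ bs)) (val (c ∷ r))
  ... | true  = rem , rem≤ , (begin
    ⟦ c ⟧ * pow q (length r) + val r
      ≈⟨ +-cong (*-congˡ (trans (reflexive (≡.cong (pow q) (≡.sym (ℕₚ.m∸n+n≡m d≤r)))) (pow-+ q (length r ∸ d) d)))
                (sym (val-subtract r cbs (≡.subst (_≤ length r) (≡.sym (Listₚ.length-map (c ℤ.*_) bs)) d≤r))) ⟩
    ⟦ c ⟧ * (P * Q) + (val r′ + pow q (length r ∸ length cbs) * val cbs)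
      ≈⟨ +-congˡ (+-cong eq (*-cong (reflexive (≡.cong (λ n → pow q (length r ∸ n)) (Listₚ.length-map (c ℤ.*_) bs))) (val-map-* c bs))) ⟩
    ⟦ c ⟧ * (P * Q) + ((val g * (𝟙 * Q + val bs) + val rem) + P * (⟦ c ⟧ * val bs))
      ≈⟨ solve 6 (λ c P Q g b m → c :* (P :* Q) :+ ((g :* (con 1ℤ :* Q :+ b) :+ m) :+ P :* (c :* b))
             := (c :* P :+ g) :* (con 1ℤ :* Q :+ b) :+ m) refl ⟦ c ⟧ P Q (val g) (val bs) (val rem) ⟩
    (⟦ c ⟧ * P + val g) * val (1ℤ ∷ bs) + val rem
      ≈⟨ +-congʳ (*-congʳ (+-congʳ (*-congˡ (reflexive (≡.cong (pow q) (≡.sym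
           (≡.trans (length-divLoop f d bs r′ r′≤f) (≡.cong (_∸ d) (length-subtract r cbs))))))))) ⟩
    (⟦ c ⟧ * pow q (length g) + val g) * val (1ℤ ∷ bs) + val rem ∎)
    where
    d   = length bs
    d≤r : d ≤ length r
    d≤r = ℕₚ.≤ᵇ⇒≤ d (length r) (≡.subst T (≡.sym d≤?r) _)
    cbs = map (c ℤ.*_) bs
    r′  = subtract r cbs
    g   = divLoop f d bs r′
    P   = pow q (length r ∸ d)
    Q   = pow q d
    r′≤f : length r′ ≤ f
    r′≤f = ≡.subst (_≤ f) (≡.sym (length-subtract r cbs)) r≤f
    ih   = division f bs r′ r′≤f
    rem  = proj₁ ih
    rem≤ = proj₁ (proj₂ ih)
    eq   = proj₂ (proj₂ ih)

  quotient-difference : ∀ {A} B Q Q′ r → A ≈ Q * B → A ≈ Q′ * B + r → (Q - Q′) * B ≈ r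
  quotient-difference {A} B Q Q′ r e e′ = begin
    (Q - Q′) * B           ≈⟨ solve 3 (λ Q Q′ B → (Q :- Q′) :* B := Q :* B :- Q′ :* B) refl Q Q′ B ⟩
    Q * B - Q′ * B         ≈⟨ +-congʳ (trans (sym e) e′) ⟩
    (Q′ * B + r) - Q′ * B  ≈⟨ solve 2 (λ x r → (x :+ r) :- x := r) refl (Q′ * B) r ⟩
    r                      ∎

  difference-zero : ∀ x y → x - y ≈ 0# → x ≈ y
  difference-zero x y e = begin
    x            ≈⟨ solve 2 (λ x y → x := (x :- y) :+ y) refl x y ⟩
    (x - y) + y  ≈⟨ +-congʳ e ⟩
    0# + y       ≈⟨ +-identityˡ y ⟩
    y            ∎

  append-val : ∀ a c p P {p′} → p′ ≈ c * P + p → a + q * p′ ≈ c * (q * P) + (a + q * p)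
  append-val a c p P e = trans (+-congˡ (*-congˡ e))
    (solve 5 (λ a c p P q → a :+ q :* (c :* P :+ p) := c :* (q :* P) :+ (a :+ q :* p)) refl a c p P q)

-- The ring of integer polynomials

-- A record, so that the two polynomials can be inferred from a proof of their equality.
infix 4 _≋P_
record _≋P_ (p r : Poly) : Set where
  constructor coeffs
  field coeff≡ : p ≈P r
open _≋P_ public

negP : Poly → Poly
negP = map (λ a → ℤ.- a)

coeff-⊕ : ∀ p r m → coeff (p ⊕ r) m ≡ coeff p m ℤ.+ coeff r m
coeff-⊕ []      r       m       = ≡.sym (ℤₚ.+-identityˡ (coeff r m))
coeff-⊕ (a ∷ p) []      m       = ≡.sym (ℤₚ.+-identityʳ (coeff (a ∷ p) m))
coeff-⊕ (a ∷ p) (b ∷ r) zero    = ≡.refl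
coeff-⊕ (a ∷ p) (b ∷ r) (suc m) = coeff-⊕ p r m

coeff-scale : ∀ c p m → coeff (scale c p) m ≡ c ℤ.* coeff p m
coeff-scale c []      m       = ≡.sym (ℤₚ.*-zeroʳ c)
coeff-scale c (a ∷ p) zero    = ≡.refl
coeff-scale c (a ∷ p) (suc m) = coeff-scale c p m

coeff-negP : ∀ p m → coeff (negP p) m ≡ ℤ.- coeff p m
coeff-negP []      m       = ≡.refl
coeff-negP (a ∷ p) zero    = ≡.refl
coeff-negP (a ∷ p) (suc m) = coeff-negP p m

coeff-⊛-zero : ∀ a p r → coeff ((a ∷ p) ⊛ r) 0 ≡ a ℤ.* coeff r 0
coeff-⊛-zero a p r = ≡.trans (coeff-⊕ (scale a r) (0ℤ ∷ p ⊛ r) 0)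
  (≡.trans (ℤₚ.+-identityʳ _) (coeff-scale a r 0))

coeff-⊛-suc : ∀ a p r m → coeff ((a ∷ p) ⊛ r) (suc m) ≡ a ℤ.* coeff r (suc m) ℤ.+ coeff (p ⊛ r) m
coeff-⊛-suc a p r m = ≡.trans (coeff-⊕ (scale a r) (0ℤ ∷ p ⊛ r) (suc m))
  (≡.cong (ℤ._+ coeff (p ⊛ r) m) (coeff-scale a r (suc m)))

⊛-congˡ : ∀ p {r s} → r ≈P s → p ⊛ r ≈P p ⊛ s
⊛-congˡ []      eq m = ≡.refl
⊛-congˡ (a ∷ p) {r} {s} eq zero = ≡.trans (coeff-⊛-zero a p r)
  (≡.trans (≡.cong (a ℤ.*_) (eq 0)) (≡.sym (coeff-⊛-zero a p s)))
⊛-congˡ (a ∷ p) {r} {s} eq (suc m) = ≡.trans (coeff-⊛-suc a p r m)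
  (≡.trans (≡.cong₂ (λ x y → a ℤ.* x ℤ.+ y) (eq (suc m)) (⊛-congˡ p {r} {s} eq m)) (≡.sym (coeff-⊛-suc a p s m)))

⊛-zeroʳ : ∀ p → p ⊛ [] ≈P []
⊛-zeroʳ []      m       = ≡.refl
⊛-zeroʳ (a ∷ p) zero    = ≡.refl
⊛-zeroʳ (a ∷ p) (suc m) = ⊛-zeroʳ p m

coeff-⊛-zeroʳ : ∀ p b r → coeff (p ⊛ (b ∷ r)) 0 ≡ b ℤ.* coeff p 0
coeff-⊛-zeroʳ []      b r = ≡.sym (ℤₚ.*-zeroʳ b)
coeff-⊛-zeroʳ (a ∷ p) b r = ≡.trans (coeff-⊛-zero a p (b ∷ r)) (ℤₚ.*-comm a b)

-- The defining recursion of the product, along the other factor; commutativity is the agreement of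
-- the two.
coeff-⊛-sucʳ : ∀ p b r m → coeff (p ⊛ (b ∷ r)) (suc m) ≡ b ℤ.* coeff p (suc m) ℤ.+ coeff (p ⊛ r) m
coeff-⊛-sucʳ []      b r m = ≡.sym (≡.trans (ℤₚ.+-identityʳ _) (ℤₚ.*-zeroʳ b))
coeff-⊛-sucʳ (a ∷ p) b r zero = ≡.trans (coeff-⊛-suc a p (b ∷ r) 0)
  (≡.trans (≡.cong (λ x → a ℤ.* coeff r 0 ℤ.+ x) (coeff-⊛-zeroʳ p b r))
    (≡.trans (ℤₚ.+-comm (a ℤ.* coeff r 0) _) (≡.cong (λ x → b ℤ.* coeff p 0 ℤ.+ x) (≡.sym (coeff-⊛-zero a p r)))))
coeff-⊛-sucʳ (a ∷ p) b r (suc m) = ≡.trans (coeff-⊛-suc a p (b ∷ r) (suc m))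
  (≡.trans (≡.cong (λ x → a ℤ.* coeff r (suc m) ℤ.+ x) (coeff-⊛-sucʳ p b r m))
    (≡.trans (exchange (a ℤ.* coeff r (suc m)) (b ℤ.* coeff p (suc m)) (coeff (p ⊛ r) m))
      (≡.cong (λ x → b ℤ.* coeff p (suc m) ℤ.+ x) (≡.sym (coeff-⊛-suc a p r m)))))
  where
  exchange : ∀ x y z → x ℤ.+ (y ℤ.+ z) ≡ y ℤ.+ (x ℤ.+ z)
  exchange = ℤ-solve

⊛-comm : ∀ p r → p ⊛ r ≈P r ⊛ p
⊛-comm []      r m       = ≡.sym (⊛-zeroʳ r m)
⊛-comm (a ∷ p) r zero    = ≡.trans (coeff-⊛-zero a p r) (≡.sym (coeff-⊛-zeroʳ r a p))
⊛-comm (a ∷ p) r (suc m) = ≡.trans (coeff-⊛-suc a p r m)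
  (≡.trans (≡.cong (λ x → a ℤ.* coeff r (suc m) ℤ.+ x) (⊛-comm p r m)) (≡.sym (coeff-⊛-sucʳ r a p m)))

⊛-congʳ : ∀ s {p r} → p ≈P r → p ⊛ s ≈P r ⊛ s
⊛-congʳ s {p} {r} eq m = ≡.trans (⊛-comm p s m) (≡.trans (⊛-congˡ s {p} {r} eq m) (⊛-comm s r m))

⊛-distribˡ-⊕ : ∀ p r s → p ⊛ (r ⊕ s) ≈P p ⊛ r ⊕ p ⊛ s
⊛-distribˡ-⊕ []      r s m    = ≡.refl
⊛-distribˡ-⊕ (a ∷ p) r s zero = begin
  coeff ((a ∷ p) ⊛ (r ⊕ s)) 0              ≡⟨ coeff-⊛-zero a p (r ⊕ s) ⟩
  a ℤ.* coeff (r ⊕ s) 0                    ≡⟨ ≡.cong (a ℤ.*_) (coeff-⊕ r s 0) ⟩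
  a ℤ.* (coeff r 0 ℤ.+ coeff s 0)          ≡⟨ ℤₚ.*-distribˡ-+ a (coeff r 0) (coeff s 0) ⟩
  a ℤ.* coeff r 0 ℤ.+ a ℤ.* coeff s 0      ≡⟨ ≡.cong₂ ℤ._+_ (coeff-⊛-zero a p r) (coeff-⊛-zero a p s) ⟨
  coeff ((a ∷ p) ⊛ r) 0 ℤ.+ coeff ((a ∷ p) ⊛ s) 0
    ≡⟨ coeff-⊕ ((a ∷ p) ⊛ r) ((a ∷ p) ⊛ s) 0 ⟨
  coeff ((a ∷ p) ⊛ r ⊕ (a ∷ p) ⊛ s) 0      ∎
  where open ≡.≡-Reasoning
⊛-distribˡ-⊕ (a ∷ p) r s (suc m) = begin
  coeff ((a ∷ p) ⊛ (r ⊕ s)) (suc m)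
    ≡⟨ coeff-⊛-suc a p (r ⊕ s) m ⟩
  a ℤ.* coeff (r ⊕ s) (suc m) ℤ.+ coeff (p ⊛ (r ⊕ s)) m
    ≡⟨ ≡.cong₂ (λ x y → a ℤ.* x ℤ.+ y) (coeff-⊕ r s (suc m)) (≡.trans (⊛-distribˡ-⊕ p r s m) (coeff-⊕ (p ⊛ r) (p ⊛ s) m)) ⟩
  a ℤ.* (coeff r (suc m) ℤ.+ coeff s (suc m)) ℤ.+ (coeff (p ⊛ r) m ℤ.+ coeff (p ⊛ s) m)
    ≡⟨ regroup a (coeff r (suc m)) (coeff s (suc m)) (coeff (p ⊛ r) m) (coeff (p ⊛ s) m) ⟩
  (a ℤ.* coeff r (suc m) ℤ.+ coeff (p ⊛ r) m) ℤ.+ (a ℤ.* coeff s (suc m) ℤ.+ coeff (p ⊛ s) m)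
    ≡⟨ ≡.cong₂ ℤ._+_ (coeff-⊛-suc a p r m) (coeff-⊛-suc a p s m) ⟨
  coeff ((a ∷ p) ⊛ r) (suc m) ℤ.+ coeff ((a ∷ p) ⊛ s) (suc m)
    ≡⟨ coeff-⊕ ((a ∷ p) ⊛ r) ((a ∷ p) ⊛ s) (suc m) ⟨
  coeff ((a ∷ p) ⊛ r ⊕ (a ∷ p) ⊛ s) (suc m) ∎
  where
  open ≡.≡-Reasoning
  regroup : ∀ a x y z w → a ℤ.* (x ℤ.+ y) ℤ.+ (z ℤ.+ w) ≡ (a ℤ.* x ℤ.+ z) ℤ.+ (a ℤ.* y ℤ.+ w)
  regroup = ℤ-solve

⊕-cong : ∀ {p p′ r r′} → p ≈P p′ → r ≈P r′ → p ⊕ r ≈P p′ ⊕ r′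
⊕-cong {p} {p′} {r} {r′} e f m = ≡.trans (coeff-⊕ p r m) (≡.trans (≡.cong₂ ℤ._+_ (e m) (f m)) (≡.sym (coeff-⊕ p′ r′ m)))

⊛-distribʳ-⊕ : ∀ s p r → (p ⊕ r) ⊛ s ≈P p ⊛ s ⊕ r ⊛ s
⊛-distribʳ-⊕ s p r m = ≡.trans (⊛-comm (p ⊕ r) s m)
  (≡.trans (⊛-distribˡ-⊕ s p r m) (⊕-cong {s ⊛ p} {p ⊛ s} {s ⊛ r} {r ⊛ s} (⊛-comm s p) (⊛-comm s r) m))

scale-⊛ : ∀ c p r → scale c p ⊛ r ≈P scale c (p ⊛ r)
scale-⊛ c []      r m    = ≡.refl
scale-⊛ c (a ∷ p) r zero = ≡.trans (coeff-⊛-zero (c ℤ.* a) (scale c p) r) (≡.trans (ℤₚ.*-assoc c a (coeff r 0))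
  (≡.trans (≡.cong (c ℤ.*_) (≡.sym (coeff-⊛-zero a p r))) (≡.sym (coeff-scale c ((a ∷ p) ⊛ r) 0))))
scale-⊛ c (a ∷ p) r (suc m) = begin
  coeff (scale c (a ∷ p) ⊛ r) (suc m)
    ≡⟨ coeff-⊛-suc (c ℤ.* a) (scale c p) r m ⟩
  c ℤ.* a ℤ.* coeff r (suc m) ℤ.+ coeff (scale c p ⊛ r) m
    ≡⟨ ≡.cong (λ x → c ℤ.* a ℤ.* coeff r (suc m) ℤ.+ x) (≡.trans (scale-⊛ c p r m) (coeff-scale c (p ⊛ r) m)) ⟩
  c ℤ.* a ℤ.* coeff r (suc m) ℤ.+ c ℤ.* coeff (p ⊛ r) m
    ≡⟨ factor c a (coeff r (suc m)) (coeff (p ⊛ r) m) ⟩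
  c ℤ.* (a ℤ.* coeff r (suc m) ℤ.+ coeff (p ⊛ r) m)
    ≡⟨ ≡.cong (c ℤ.*_) (coeff-⊛-suc a p r m) ⟨
  c ℤ.* coeff ((a ∷ p) ⊛ r) (suc m)
    ≡⟨ coeff-scale c ((a ∷ p) ⊛ r) (suc m) ⟨
  coeff (scale c ((a ∷ p) ⊛ r)) (suc m) ∎
  where
  open ≡.≡-Reasoning
  factor : ∀ c a x y → c ℤ.* a ℤ.* x ℤ.+ c ℤ.* y ≡ c ℤ.* (a ℤ.* x ℤ.+ y)
  factor = ℤ-solve

0∷-⊛ : ∀ p r → (0ℤ ∷ p) ⊛ r ≈P 0ℤ ∷ p ⊛ r
0∷-⊛ p r zero    = ≡.trans (coeff-⊛-zero 0ℤ p r) (ℤₚ.*-zeroˡ (coeff r 0))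
0∷-⊛ p r (suc m) = ≡.trans (coeff-⊛-suc 0ℤ p r m)
  (≡.trans (≡.cong (ℤ._+ coeff (p ⊛ r) m) (ℤₚ.*-zeroˡ (coeff r (suc m)))) (ℤₚ.+-identityˡ _))

⊛-assoc : ∀ p r s → (p ⊛ r) ⊛ s ≈P p ⊛ (r ⊛ s)
⊛-assoc []      r s m = ≡.refl
⊛-assoc (a ∷ p) r s m = ≡.trans (⊛-distribʳ-⊕ s (scale a r) (0ℤ ∷ p ⊛ r) m)
  (⊕-cong {scale a r ⊛ s} {scale a (r ⊛ s)} {(0ℤ ∷ p ⊛ r) ⊛ s} {0ℤ ∷ p ⊛ (r ⊛ s)} (scale-⊛ a r s) (λ n → ≡.trans (0∷-⊛ (p ⊛ r) s n) (0∷-cong n)) m)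
  where
  0∷-cong : 0ℤ ∷ (p ⊛ r) ⊛ s ≈P 0ℤ ∷ p ⊛ (r ⊛ s)
  0∷-cong zero    = ≡.refl
  0∷-cong (suc n) = ⊛-assoc p r s n

constant-⊛ : ∀ c p → (c ∷ []) ⊛ p ≈P scale c p
constant-⊛ c p m = ≡.trans (coeff-⊕ (scale c p) (0ℤ ∷ []) m)
  (≡.trans (≡.cong (λ x → coeff (scale c p) m ℤ.+ x) (zeros m)) (ℤₚ.+-identityʳ _))
  where
  zeros : ∀ m → coeff (0ℤ ∷ []) m ≡ 0ℤ
  zeros zero    = ≡.refl
  zeros (suc m) = ≡.refl

⊛-identityˡ : ∀ p → (1ℤ ∷ []) ⊛ p ≈P p
⊛-identityˡ p m = ≡.trans (constant-⊛ 1ℤ p m) (≡.trans (coeff-scale 1ℤ p m) (ℤₚ.*-identityˡ _))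

polyRing : CommutativeRing 0ℓ 0ℓ
polyRing = record
  { Carrier = Poly ; _≈_ = _≋P_ ; _+_ = _⊕_ ; _*_ = _⊛_ ; -_ = negP ; 0# = [] ; 1# = 1ℤ ∷ []
  ; isCommutativeRing = record
    { isRing = record
      { +-isAbelianGroup = record
        { isGroup = record
          { isMonoid = record
            { isSemigroup = record
              { isMagma = record
                { isEquivalence = record
                  { refl  = coeffs λ _ → ≡.refl
                  ; sym   = λ e → coeffs λ m → ≡.sym (coeff≡ e m)
                  ; trans = λ e f → coeffs λ m → ≡.trans (coeff≡ e m) (coeff≡ f m)
                  }
                ; ∙-cong = λ {p} {p′} {r} {r′} e f → coeffs (⊕-cong {p} {p′} {r} {r′} (coeff≡ e) (coeff≡ f))
                }
              ; assoc = λ p r s → coeffs λ m → begin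
                  coeff (p ⊕ r ⊕ s) m                          ≡⟨ coeff-⊕ (p ⊕ r) s m ⟩
                  coeff (p ⊕ r) m ℤ.+ coeff s m                ≡⟨ ≡.cong (ℤ._+ coeff s m) (coeff-⊕ p r m) ⟩
                  coeff p m ℤ.+ coeff r m ℤ.+ coeff s m        ≡⟨ ℤₚ.+-assoc (coeff p m) (coeff r m) (coeff s m) ⟩
                  coeff p m ℤ.+ (coeff r m ℤ.+ coeff s m)      ≡⟨ ≡.cong (λ x → coeff p m ℤ.+ x) (coeff-⊕ r s m) ⟨
                  coeff p m ℤ.+ coeff (r ⊕ s) m                ≡⟨ coeff-⊕ p (r ⊕ s) m ⟨
                  coeff (p ⊕ (r ⊕ s)) m                        ∎
              }
            ; identity = (λ p → coeffs λ m → ≡.refl)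
                       , (λ p → coeffs λ m → ≡.trans (coeff-⊕ p [] m) (ℤₚ.+-identityʳ (coeff p m)))
            }
          ; inverse = (λ p → coeffs λ m → ≡.trans (coeff-⊕ (negP p) p m)
                        (≡.trans (≡.cong (ℤ._+ coeff p m) (coeff-negP p m)) (ℤₚ.+-inverseˡ (coeff p m))))
                    , (λ p → coeffs λ m → ≡.trans (coeff-⊕ p (negP p) m)
                        (≡.trans (≡.cong (λ x → coeff p m ℤ.+ x) (coeff-negP p m)) (ℤₚ.+-inverseʳ (coeff p m))))
          ; ⁻¹-cong = λ {p} {r} e → coeffs λ m → ≡.trans (coeff-negP p m)
                        (≡.trans (≡.cong (λ a → ℤ.- a) (coeff≡ e m)) (≡.sym (coeff-negP r m)))
          }
        ; comm = λ p r → coeffs λ m → ≡.trans (coeff-⊕ p r m)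
                   (≡.trans (ℤₚ.+-comm (coeff p m) (coeff r m)) (≡.sym (coeff-⊕ r p m)))
        }
      ; *-cong = λ {p} {r} {s} {t} e f → coeffs λ m → ≡.trans (⊛-congʳ s {p} {r} (coeff≡ e) m) (⊛-congˡ r {s} {t} (coeff≡ f) m)
      ; *-assoc = λ p r s → coeffs (⊛-assoc p r s)
      ; *-identity = (λ p → coeffs (⊛-identityˡ p))
                   , (λ p → coeffs λ m → ≡.trans (⊛-comm p (1ℤ ∷ []) m) (⊛-identityˡ p m))
      ; distrib = (λ p r s → coeffs (⊛-distribˡ-⊕ p r s)) , (λ s p r → coeffs (⊛-distribʳ-⊕ s p r))
      }
    ; *-comm = λ p r → coeffs (⊛-comm p r)
    }
  }
  where open ≡.≡-Reasoning

constants : ℤ-rawRing -Raw-AlmostCommutative⟶ fromCommutativeRing polyRing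
constants = record
  { ⟦_⟧    = λ c → c ∷ []
  ; +-homo = λ a b → coeffs λ _ → ≡.refl
  ; *-homo = λ a b → coeffs λ m → ≡.sym (constant-⊛ a (b ∷ []) m)
  ; -‿homo = λ a → coeffs λ _ → ≡.refl
  ; 0-homo = coeffs λ { zero → ≡.refl ; (suc _) → ≡.refl }
  ; 1-homo = coeffs λ _ → ≡.refl
  }

qvar : Poly
qvar = qpow 1

private
  module P where
    open CommutativeRing polyRing public hiding (zero)
    open QAlgebra polyRing constants qvar public

qvar-⊛ : ∀ p → qvar ⊛ p ≋P 0ℤ ∷ p
qvar-⊛ p = coeffs λ m → ≡.trans (0∷-⊛ (1ℤ ∷ []) p m) (0∷-cong m)
  where
  0∷-cong : 0ℤ ∷ ((1ℤ ∷ []) ⊛ p) ≈P 0ℤ ∷ p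
  0∷-cong zero    = ≡.refl
  0∷-cong (suc m) = ⊛-identityˡ p m

∷-horner : ∀ a p → a ∷ p ≋P (a ∷ []) ⊕ qvar ⊛ p
∷-horner a p = coeffs λ m → ≡.trans (lemma m) (⊕-cong {a ∷ []} {a ∷ []} {0ℤ ∷ p} {qvar ⊛ p} (λ _ → ≡.refl) (λ n → ≡.sym (coeff≡ (qvar-⊛ p) n)) m)
  where
  lemma : a ∷ p ≈P (a ∷ []) ⊕ (0ℤ ∷ p)
  lemma zero    = ≡.sym (ℤₚ.+-identityʳ a)
  lemma (suc m) = ≡.refl

qpow-pow : ∀ m → qpow m ≋P P.pow qvar m
qpow-pow zero    = P.refl
qpow-pow (suc m) = P.trans (P.sym (qvar-⊛ (qpow m))) (P.*-cong (P.refl {qvar}) (qpow-pow m))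

^P-pow : ∀ e → oneMinusQ ^P e ≡ P.pow (P.𝟙 P.- qvar) e
^P-pow zero    = ≡.refl
^P-pow (suc e) = ≡.cong (oneMinusQ ⊛_) (^P-pow e)

qint-qInt : ∀ h → qint h ≋P P.qInt h
qint-qInt zero    = P.sym (_-Raw-AlmostCommutative⟶_.0-homo constants)
qint-qInt (suc h) = P.trans (∷-horner 1ℤ (qint h)) (P.+-cong (P.refl {1ℤ ∷ []}) (P.*-cong (P.refl {qvar}) (qint-qInt h)))

qfact-qFact : ∀ n → qfact n ≋P P.qFact n
qfact-qFact zero    = P.refl
qfact-qFact (suc n) = P.*-cong (qfact-qFact n) (qint-qInt (suc n))

∷ʳ-val : ∀ p c → p ++ c ∷ [] ≋P (c ∷ []) ⊛ P.pow qvar (length p) ⊕ p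
∷ʳ-val []      c = P.sym (P.trans (P.+-identityʳ _) (P.*-identityʳ (c ∷ [])))
∷ʳ-val (a ∷ p) c = P.trans (∷-horner a (p ++ c ∷ []))
  (P.trans (P.append-val (a ∷ []) (c ∷ []) p (P.pow qvar (length p)) (∷ʳ-val p c))
    (P.+-cong (P.refl {(c ∷ []) ⊛ P.pow qvar (length (a ∷ p))}) (P.sym (∷-horner a p))))

reverse-val : ∀ l → reverse l ≋P P.val l
reverse-val []      = P.sym (_-Raw-AlmostCommutative⟶_.0-homo constants)
reverse-val (c ∷ l) rewrite Listₚ.unfold-reverse c l = P.trans (∷ʳ-val (reverse l) c)
  (P.+-cong (P.reflexive (≡.cong (λ n → (c ∷ []) ⊛ P.pow qvar n) (Listₚ.length-reverse l))) (reverse-val l))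

-- Monic divisors and exact division

Monic : ℕ → Poly → Set
Monic d p = coeff p d ≡ 1ℤ × (∀ m → d < m → coeff p m ≡ 0ℤ)

monic-qint : ∀ n → Monic n (qint (suc n))
monic-qint zero    = ≡.refl , λ { (suc m) _ → ≡.refl }
monic-qint (suc n) = proj₁ (monic-qint n) , λ { (suc m) (s≤s n<m) → proj₂ (monic-qint n) m n<m }

vanish-⊛ : ∀ p r → p ≋P [] → ∀ m → coeff (p ⊛ r) m ≡ 0ℤ
vanish-⊛ p r p≋0 m = ⊛-congʳ r {p} {[]} (coeff≡ p≋0) m

monic-⊛ : ∀ {d e} p r → Monic d p → Monic e r → Monic (d ℕ.+ e) (p ⊛ r)
monic-⊛ {zero} {e} [] r (() , _) _
monic-⊛ {zero} {e} (a ∷ p) r (a≡1 , high) (r≡1 , rhigh) =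
  ≡.trans (same e) r≡1 , λ m e<m → ≡.trans (same m) (rhigh m e<m)
  where
  p≋0 : p ≋P []
  p≋0 = coeffs λ m → high (suc m) (s≤s z≤n)
  same : ∀ m → coeff ((a ∷ p) ⊛ r) m ≡ coeff r m
  same zero    = ≡.trans (coeff-⊛-zero a p r) (≡.trans (≡.cong (ℤ._* coeff r 0) a≡1) (ℤₚ.*-identityˡ (coeff r 0)))
  same (suc m) = ≡.trans (coeff-⊛-suc a p r m)
    (≡.trans (≡.cong₂ (λ x y → x ℤ.* coeff r (suc m) ℤ.+ y) a≡1 (vanish-⊛ p r p≋0 m))
      (≡.trans (ℤₚ.+-identityʳ _) (ℤₚ.*-identityˡ (coeff r (suc m)))))
monic-⊛ {suc d} {e} (a ∷ p) r (p≡1 , high) mr@(r≡1 , rhigh) =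
  ≡.trans (same (d ℕ.+ e) (ℕₚ.m≤n+m e d)) (proj₁ ih) ,
  λ { (suc m) (s≤s d+e<m) → ≡.trans (same m (ℕₚ.≤-trans (ℕₚ.m≤n+m e d) (ℕₚ.<⇒≤ d+e<m))) (proj₂ ih m d+e<m) }
  where
  ih = monic-⊛ {d} {e} p r (p≡1 , λ m d<m → high (suc m) (s≤s d<m)) mr
  same : ∀ m → e ≤ m → coeff ((a ∷ p) ⊛ r) (suc m) ≡ coeff (p ⊛ r) m
  same m e≤m = ≡.trans (coeff-⊛-suc a p r m) (≡.trans
    (≡.cong (λ x → a ℤ.* x ℤ.+ coeff (p ⊛ r) m) (rhigh (suc m) (s≤s e≤m)))
    (≡.trans (≡.cong (ℤ._+ coeff (p ⊛ r) m) (ℤₚ.*-zeroʳ a)) (ℤₚ.+-identityˡ _)))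

monic-qfact : ∀ n → ∃ λ d → Monic d (qfact n)
monic-qfact zero    = 0 , ≡.refl , λ { (suc m) _ → ≡.refl }
monic-qfact (suc n) = _ , monic-⊛ (qfact n) (qint (suc n)) (proj₂ (monic-qfact n)) (monic-qint n)

-- Reads off the coefficients of p from the lowest one: the constant term of p is the coefficient of
-- degree d in p ⊛ D once the higher ones vanish.
monic-cancel : ∀ {d} p D → Monic d D → (∀ m → d ≤ m → coeff (p ⊛ D) m ≡ 0ℤ) → p ≋P []
monic-cancel {d} []      D mD         vanish = P.refl
monic-cancel {d} (a ∷ p) D mD@(D≡1 , high) vanish = coeffs λ { zero → a≡0 d D≡1 (vanish d ℕₚ.≤-refl) ; (suc m) → coeff≡ p≋0 m }
  where
  p≋0 : p ≋P []
  p≋0 = monic-cancel p D mD λ m d≤m → begin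
    coeff (p ⊛ D) m                             ≡⟨ ℤₚ.+-identityˡ _ ⟨
    0ℤ ℤ.+ coeff (p ⊛ D) m                      ≡⟨ ≡.cong (ℤ._+ coeff (p ⊛ D) m) (ℤₚ.*-zeroʳ a) ⟨
    a ℤ.* 0ℤ ℤ.+ coeff (p ⊛ D) m                ≡⟨ ≡.cong (λ x → a ℤ.* x ℤ.+ coeff (p ⊛ D) m) (high (suc m) (s≤s d≤m)) ⟨
    a ℤ.* coeff D (suc m) ℤ.+ coeff (p ⊛ D) m   ≡⟨ coeff-⊛-suc a p D m ⟨
    coeff ((a ∷ p) ⊛ D) (suc m)                 ≡⟨ vanish (suc m) (ℕₚ.m≤n⇒m≤1+n d≤m) ⟩
    0ℤ                                          ∎
    where open ≡.≡-Reasoning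
  a≡0 : ∀ e → coeff D e ≡ 1ℤ → coeff ((a ∷ p) ⊛ D) e ≡ 0ℤ → a ≡ 0ℤ
  a≡0 zero    De≡1 e≡0 = ≡.trans (≡.sym (ℤₚ.*-identityʳ a)) (≡.trans (≡.cong (a ℤ.*_) (≡.sym De≡1))
    (≡.trans (≡.sym (coeff-⊛-zero a p D)) e≡0))
  a≡0 (suc e) De≡1 e≡0 = begin
    a                                           ≡⟨ ℤₚ.*-identityʳ a ⟨
    a ℤ.* 1ℤ                                    ≡⟨ ℤₚ.+-identityʳ _ ⟨
    a ℤ.* 1ℤ ℤ.+ 0ℤ                             ≡⟨ ≡.cong₂ (λ x y → a ℤ.* x ℤ.+ y) De≡1 (vanish-⊛ p D p≋0 e) ⟨
    a ℤ.* coeff D (suc e) ℤ.+ coeff (p ⊛ D) e   ≡⟨ coeff-⊛-suc a p D e ⟨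
    coeff ((a ∷ p) ⊛ D) (suc e)                 ≡⟨ e≡0 ⟩
    0ℤ                                          ∎
    where open ≡.≡-Reasoning

coeff-beyond : ∀ p m → length p ≤ m → coeff p m ≡ 0ℤ
coeff-beyond []      m       _         = ≡.refl
coeff-beyond (a ∷ p) (suc m) (s≤s p≤m) = coeff-beyond p m p≤m

coeff-∷ʳ : ∀ p c → coeff (p ++ c ∷ []) (length p) ≡ c
coeff-∷ʳ []      c = ≡.refl
coeff-∷ʳ (a ∷ p) c = coeff-∷ʳ p c

coeff-reverse-∷ : ∀ c l → coeff (reverse (c ∷ l)) (length l) ≡ c
coeff-reverse-∷ c l = ≡.trans
  (≡.cong₂ coeff (Listₚ.unfold-reverse c l) (≡.sym (Listₚ.length-reverse l)))
  (coeff-∷ʳ (reverse l) c)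

dropZeros-head : ∀ p l {c bs} → dropZeros p l ≡ c ∷ bs → c ≡.≢ 0ℤ
dropZeros-head p (+ zero ∷ l)   e           = dropZeros-head p l e
dropZeros-head p (+ suc n ∷ l)  ≡.refl ()
dropZeros-head p (-[1+ n ] ∷ l) ≡.refl ()

reverse-trim : ∀ p → reverse (trim p) ≡ dropZeros p (reverse p)
reverse-trim p = ≡.trans (≡.cong reverse (trim-unfold p)) (Listₚ.reverse-involutive _)

val-reverse-trim : ∀ p → P.val (reverse (trim p)) ≋P p
val-reverse-trim p rewrite reverse-trim p = P.trans (P.val-dropZeros p (reverse p))
  (P.trans (P.sym (reverse-val (reverse p))) (P.reflexive (Listₚ.reverse-involutive p)))

-- A trimmed list starts, read from the top, with a nonzero entry. A longer list would contradict
-- vanishing above degree d, a shorter one the coefficient 1 in degree d.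
monic-trim : ∀ {d} p → Monic d p → ∃ λ bs → reverse (trim p) ≡ 1ℤ ∷ bs × length bs ≡ d
monic-trim {d} p (p≡1 , high) = leading (reverse (trim p)) ≡.refl
  where
  leading : ∀ l → reverse (trim p) ≡ l → ∃ λ bs → l ≡ 1ℤ ∷ bs × length bs ≡ d
  leading l e = split l e (coeff≡ (P.trans (reverse-val l) (P.trans (P.reflexive (≡.cong P.val (≡.sym e))) (val-reverse-trim p))))
    where
    split : ∀ l → reverse (trim p) ≡ l → reverse l ≈P p → ∃ λ bs → l ≡ 1ℤ ∷ bs × length bs ≡ d
    split []       e l≈p = contradiction (≡.trans (l≈p d) p≡1) λ ()
    split (c ∷ bs) e l≈p with ℕₚ.<-cmp (length bs) d
    ... | tri< bs<d _ _ = contradiction (≡.trans (≡.sym (coeff-beyond (reverse (c ∷ bs)) d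
            (≡.subst (_≤ d) (≡.sym (Listₚ.length-reverse (c ∷ bs))) bs<d))) (≡.trans (l≈p d) p≡1)) λ ()
    ... | tri> _ _ d<bs = contradiction
            (≡.trans (≡.sym (coeff-reverse-∷ c bs)) (≡.trans (l≈p (length bs)) (high (length bs) d<bs)))
            (dropZeros-head p (reverse p) (≡.trans (≡.sym (reverse-trim p)) e))
    ... | tri≈ _ ≡.refl _ = bs , ≡.cong (_∷ bs)
            (≡.trans (≡.sym (coeff-reverse-∷ c bs)) (≡.trans (l≈p d) p≡1)) , ≡.refl

-- Uniqueness of the quotient: Q minus the computed quotient, times B, is a remainder of degree
-- below d, which a monic B permits only if the difference is zero.
divMonic-exact : ∀ {d} A B Q → Monic d B → A ≋P Q ⊛ B → divMonic A B ≋P Q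
divMonic-exact {d} A B Q monic A≋QB =
  let (bs , trim≡ , len≡)    = monic-trim B monic
      rA                     = reverse (trim A)
      (rem , rem≤ , divided) = P.division (length rA) bs rA ℕₚ.≤-refl
      g                      = divLoop (length rA) (length bs) bs rA
      B≋  : P.val (1ℤ ∷ bs) ≋P B
      B≋  = P.trans (P.reflexive (≡.cong P.val (≡.sym trim≡))) (val-reverse-trim B)
      A≋  : A ≋P P.val g ⊛ B ⊕ P.val rem
      A≋  = P.trans (P.sym (val-reverse-trim A)) (P.trans divided
              (P.+-cong (P.*-cong (P.refl {P.val g}) B≋) (P.refl {P.val rem})))
      diff : (Q P.- P.val g) ⊛ B ≋P reverse rem
      diff = P.trans (P.quotient-difference B Q (P.val g) (P.val rem) A≋QB A≋) (P.sym (reverse-val rem))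
      zero-diff : Q P.- P.val g ≋P []
      zero-diff = monic-cancel (Q P.- P.val g) B monic λ m d≤m → ≡.trans (coeff≡ diff m)
        (coeff-beyond (reverse rem) m (≡.subst (_≤ m) (≡.sym (Listₚ.length-reverse rem))
          (ℕₚ.≤-trans rem≤ (ℕₚ.≤-trans (ℕₚ.≤-reflexive len≡) d≤m))))
  in P.trans (P.reflexive (divMonic-unfold A B 1ℤ bs trim≡))
       (P.trans (reverse-val g) (P.sym (P.difference-zero Q (P.val g) zero-diff)))

qbinom-gauss : ∀ a b → qbinom (a ℕ.+ b) a ≋P P.gauss a b
qbinom-gauss a b rewrite ≤⇒≤ᵇ≡true (ℕₚ.m≤m+n a b) | ℕₚ.m+n∸m≡n a b =
  divMonic-exact (qfact (a ℕ.+ b)) (qfact a ⊛ qfact b) (P.gauss a b)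
    (monic-⊛ (qfact a) (qfact b) (proj₂ (monic-qfact a)) (proj₂ (monic-qfact b)))
    (P.trans (qfact-qFact (a ℕ.+ b)) (P.trans (P.qFact-gauss a b)
      (P.*-cong (P.refl {P.gauss a b}) (P.sym (P.*-cong (qfact-qFact a) (qfact-qFact b))))))

-- The two sides of the identity

open _-Raw-AlmostCommutative⟶_ constants using () renaming (⟦_⟧ to ι)

ι-binom : ∀ m κ → ι (+ (m C κ)) ≋P P.binom m κ
ι-binom m       zero    = P.reflexive (≡.cong (λ c → ι (+ c)) (≡.trans (nCk≡nC[n∸k] {0} {m} z≤n) (nCn≡1 m)))
ι-binom zero    (suc κ) = P.reflexive (≡.cong (λ c → ι (+ c)) (k>n⇒nCk≡0 {0} {suc κ} (s≤s z≤n)))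
ι-binom (suc m) (suc κ) = P.trans
  (P.reflexive (≡.cong (λ c → ι (+ c)) (≡.sym (nCk+nC[k+1]≡[n+1]C[k+1] m κ))))
  (P.+-cong (ι-binom m κ) (ι-binom m (suc κ)))

C2-triangle : ∀ j → suc j C 2 ≡ P.triangle j
C2-triangle zero    = ≡.refl
C2-triangle (suc j) = ≡.trans (≡.sym (nCk+nC[k+1]≡[n+1]C[k+1] (suc j) 1))
  (≡.cong₂ ℕ._+_ (nC1≡n (suc j)) (C2-triangle j))

ι-sign : ∀ j → ι (sign j) ≡ P.sgn j
ι-sign zero    = ≡.refl
ι-sign (suc j) = ≡.cong negP (ι-sign j)

-- C(t - 1 + κ, κ), with value 0 at t = 0.
C-pred : ℕ → ℕ → ℕ
C-pred κ zero    = 0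
C-pred κ (suc t) = (t ℕ.+ κ) C κ

B-suc : ∀ κ s i j → i ≤ s → B (suc κ ℕ.+ s) (suc κ) i j ≡
  + ((κ ℕ.+ s ℕ.+ j) C κ) ℤ.* + ((s ∸ i ℕ.+ κ) C κ) ℤ.- + ((suc (κ ℕ.+ s) ℕ.+ j) C κ) ℤ.* + C-pred κ (s ∸ i)
B-suc κ s i j i≤s = ≡.trans
  (≡.cong (λ z → + m₁ ℤ.* binomZ (z ℤ.- 1ℤ) (+ κ) ℤ.- + m₂ ℤ.* binomZ (z ℤ.- + 2) (+ κ)) difference)
  (≡.cong (λ c → + m₁ ℤ.* + ((s ∸ i ℕ.+ κ) C κ) ℤ.- + m₂ ℤ.* c) (second κ (s ∸ i)))
  where
  m₁ = (κ ℕ.+ s ℕ.+ j) C κ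
  m₂ = (suc (κ ℕ.+ s) ℕ.+ j) C κ
  difference : + (suc κ ℕ.+ s) ℤ.- + i ≡ + suc (s ∸ i ℕ.+ κ)
  difference = ≡.trans (ℤₚ.m-n≡m⊖n (suc κ ℕ.+ s) i)
    (≡.trans (ℤₚ.⊖-≥ {suc κ ℕ.+ s} {i} (ℕₚ.≤-trans i≤s (ℕₚ.m≤n+m s (suc κ))))
      (≡.cong +_ (≡.trans (ℕₚ.+-∸-assoc (suc κ) i≤s) (≡.cong suc (ℕₚ.+-comm κ (s ∸ i))))))
  second : ∀ κ t → binomZ (+ suc (t ℕ.+ κ) ℤ.- + 2) (+ κ) ≡ + C-pred κ t
  -- The upper index is -1 over 0, where `binomZ` is 0.
  second zero    zero    = ≡.refl
  second (suc κ) zero    = ≡.cong +_ (k>n⇒nCk≡0 (ℕₚ.n<1+n κ))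
  second κ       (suc t) = ≡.refl

ι-B : ∀ κ s i j → i ≤ s → ι (B (suc κ ℕ.+ s) (suc κ) i j) ≋P
  P.binom (s ℕ.+ κ ℕ.+ j) κ ⊛ P.binom (s ∸ i ℕ.+ κ) κ
    P.- P.binom (suc (s ℕ.+ κ) ℕ.+ j) κ ⊛ P.shift (λ t → P.binom (t ℕ.+ κ) κ) (s ∸ i)
ι-B κ s i j i≤s rewrite B-suc κ s i j i≤s | ℕₚ.+-comm κ s = P.+-cong
  (P.trans (*-homo (+ ((s ℕ.+ κ ℕ.+ j) C κ)) (+ ((s ∸ i ℕ.+ κ) C κ)))
    (P.*-cong (ι-binom (s ℕ.+ κ ℕ.+ j) κ) (ι-binom (s ∸ i ℕ.+ κ) κ)))
  (P.-‿cong (P.trans (*-homo (+ ((suc (s ℕ.+ κ) ℕ.+ j) C κ)) (+ C-pred κ (s ∸ i)))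
    (P.*-cong (ι-binom (suc (s ℕ.+ κ) ℕ.+ j) κ) (ι-C-pred (s ∸ i)))))
  where
  open _-Raw-AlmostCommutative⟶_ constants using (*-homo)
  ι-C-pred : ∀ t → ι (+ C-pred κ t) ≋P P.shift (λ t → P.binom (t ℕ.+ κ) κ) t
  ι-C-pred zero    = P.refl
  ι-C-pred (suc t) = ι-binom (t ℕ.+ κ) κ

ε-qbinom : ∀ {i j} → j ≤ i → P.ε i j ≋P ι (sign j) ⊛ (qpow (suc j C 2) ⊛ qbinom i j)
ε-qbinom {i} {j} j≤i = ≡.subst (λ i → P.ε i j ≋P ι (sign j) ⊛ (qpow (suc j C 2) ⊛ qbinom i j)) (ℕₚ.m+[n∸m]≡n j≤i)
  (P.trans (P.ε-gauss j (i ∸ j)) (P.*-cong (P.reflexive (≡.sym (ι-sign j)))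
    (P.*-cong (P.trans (P.sym (qpow-pow (P.triangle j))) (P.reflexive (≡.cong qpow (≡.sym (C2-triangle j)))))
              (P.sym (qbinom-gauss j (i ∸ j))))))

rhs-term : ∀ {i j} b → j ≤ i → scale (sign j ℤ.* b) (qpow (suc j C 2) ⊛ qbinom i j) ≋P P.ε i j ⊛ ι b
rhs-term {i} {j} b j≤i = P.trans (P.sym (coeffs (constant-⊛ (sign j ℤ.* b) X)))
  (P.trans (P.*-cong (P.trans (*-homo (sign j) b) (P.*-comm (ι (sign j)) (ι b))) (P.refl {X}))
    (P.trans (P.*-assoc (ι b) (ι (sign j)) X)
      (P.trans (P.*-comm (ι b) (ι (sign j) ⊛ X)) (P.*-cong (P.sym (ε-qbinom j≤i)) (P.refl {ι b})))))
  where
  open _-Raw-AlmostCommutative⟶_ constants using (*-homo)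
  X = qpow (suc j C 2) ⊛ qbinom i j

rhsTerm : ℕ → ℕ → ℕ → ℕ → Poly
rhsTerm n k j i = scale (sign j ℤ.* B n k i j) (qpow (suc j C 2) ⊛ qbinom i j)

RHS-unfold : ∀ {n k s} → n ∸ k ≡ s →
  RHS n k ≡ P.∑ (map (λ j → P.∑ (map (rhsTerm n k j) (map (j ℕ.+_) (upTo (suc s ∸ j))))) (upTo (suc s)))
RHS-unfold ≡.refl = ≡.refl

RHS-walk : ∀ k s → RHS (k ℕ.+ s) k ≋P P.walk k 0 s
-- For n = k = 0 the convention C(-1, -1) = 1 makes `B` equal to 1.
RHS-walk zero zero = coeffs λ { zero → ≡.refl ; (suc m) → ≡.refl }
RHS-walk zero (suc s) = P.trans (P.reflexive (RHS-unfold {suc s} {0} ≡.refl))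
  (P.trans (P.∑-triangle (suc s) (rhsTerm (suc s) 0) (λ _ _ → P.𝟘)
      (λ j i _ _ → P.trans (coeffs (vanish j i)) (P.sym (_-Raw-AlmostCommutative⟶_.0-homo constants)))
      (λ _ _ _ → P.refl))
    (P.Σ<-zero (suc (suc s)) (λ _ _ → P.Σ<-zero (suc (suc s)) (λ _ _ → P.refl))))
  where
  -- For k = 0 < n both products in `B` have a first factor with lower index -1 and nonnegative
  -- upper index, so `B` computes to zero.
  vanish : ∀ j i → rhsTerm (suc s) 0 j i ≈P []
  vanish j i m = ≡.trans (coeff-scale (sign j ℤ.* 0ℤ) X m)
    (≡.trans (≡.cong (ℤ._* coeff X m) (ℤₚ.*-zeroʳ (sign j))) (ℤₚ.*-zeroˡ (coeff X m)))
    where X = qpow (suc j C 2) ⊛ qbinom i j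
RHS-walk (suc κ) s = P.trans (P.reflexive (RHS-unfold {suc κ ℕ.+ s} {suc κ} (ℕₚ.m+n∸m≡n (suc κ) s)))
  (P.trans (P.∑-triangle s (rhsTerm (suc κ ℕ.+ s) (suc κ)) F
      (λ j i j≤i i≤s → P.trans (rhs-term (B (suc κ ℕ.+ s) (suc κ) i j) j≤i) (P.*-cong (P.refl {P.ε i j}) (ι-B κ s i j i≤s)))
      (λ j i i<j → P.trans (P.*-cong (P.ε-> i<j) (P.refl {b j i}))
        (P.trans (P.*-cong (_-Raw-AlmostCommutative⟶_.0-homo constants) (P.refl {b j i})) (P.sym (_-Raw-AlmostCommutative⟶_.0-homo constants)))))
    (P.trans (P.sym (P.closed-ε κ s)) (P.sym (P.rise-closed κ 0 s))))
  where
  b F : ℕ → ℕ → Poly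
  b j i = P.binom (s ℕ.+ κ ℕ.+ j) κ ⊛ P.binom (s ∸ i ℕ.+ κ) κ
    P.- P.binom (suc (s ℕ.+ κ) ℕ.+ j) κ ⊛ P.shift (λ t → P.binom (t ℕ.+ κ) κ) (s ∸ i)
  F j i = P.ε i j ⊛ b j i

S₁-walk : ∀ k s → (oneMinusQ ^P s) ⊛ S₁ (k ℕ.+ s) k ≋P P.walk k 0 s
S₁-walk k s = P.trans
  (P.*-cong (P.reflexive (^P-pow s)) (P.trans (P.reflexive (S₁-unfold (k ℕ.+ s) k))
    (P.∑-Sym (k ℕ.+ s) k (λ σ → qpow (inv′ σ)) (λ σ → qpow-pow (inv′ σ)))))
  (P.steps-walk k k s 0 {0} ≡.refl)

theorem5p5 : (n k : ℕ) → k ≤ n →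
    (oneMinusQ ^P (n ∸ k)) ⊛ S₁ n k ≈P RHS n k
theorem5p5 n k k≤n = ≡.subst (λ n → (oneMinusQ ^P (n ∸ k)) ⊛ S₁ n k ≈P RHS n k) (ℕₚ.m+[n∸m]≡n k≤n)
  (coeff≡ (P.trans (P.reflexive (≡.cong (λ e → (oneMinusQ ^P e) ⊛ S₁ (k ℕ.+ s) k) (ℕₚ.m+n∸m≡n k s)))
    (P.trans (S₁-walk k s) (P.sym (RHS-walk k s)))))
  where s = n ∸ k
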